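{- $\mathrm{NWTL}=\mathrm{FO}$ over both finite nested words and nested $\omega$-words. That is: for every $\mathrm{NWTL}$ formula $\phi$ there is a first-order formula $\phi'(x)$ with one free variable such that $(\bar w,i)\models\phi$ iff $\bar w\models\phi'(i)$ for every (finite or infinite) nested word $\bar w$ and every position $i$ of $\bar w$; and conversely, for every first-order formula $\psi(x)$ with one free variable there is an $\mathrm{NWTL}$ formula $\psi'$ such that $\bar w\models\psi(i)$ iff $(\bar w,i)\models\psi'$ for every nested word $\bar w$ and position $i$.
   Context: Let $\Sigma$ be a finite alphabet. A matching on $\mathbb{N}$ or on an interval $[1,n]$ consists of a binary relation $\mu$ and unary relations $\mathit{call},\mathit{ret}$ such that: (1) if $\mu(i,j)$ then $\mathit{call}(i)$, $\mathit{ret}(j)$ and $i<j$; (2) if $\mu(i,j)$ and $\mu(i,j')$ then $j=j'$, and if $\mu(i,j)$ and $\mu(i',j)$ then $i=i'$; (3) if $i\le j$, $\mathit{call}(i)$ and $\mathit{ret}(j)$, then there is $k$ with $i\le k\le j$ such that $\mu(i,k)$ or $\mu(k,j)$. A finite nested word of length $n$ is $\bar w=(w,\mu,\mathit{call},\mathit{ret})$ with $w=a_1\cdots a_n\in\Sigma^*$ and $(\mu,\mathit{call},\mathit{ret})$ a matching on $[1,n]$; a nested $\omega$-word is the same with $w\in\Sigma^\omega$ and a matching on $\mathbb{N}$. If $\mu(i,j)$, $i$ is a matched call, $j$ a matched return, and we write $r(i)=j$. A nested word is identified with the first-order structure $\langle U,(P_a)_{a\in\Sigma},<,\mu,\mathit{call},\mathit{ret}\rangle$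 where $U=\{1,\dots,n\}$ or $\mathbb{N}$, $<$ is the usual order and $P_a$ the set of positions labelled $a$; FO is first-order logic over this vocabulary. A summary path between positions $i\le j$ is the sequence $i=i_0<i_1<\dots<i_k=j$ where, for all $p<k$, $i_{p+1}=r(i_p)$ if $i_p$ is a matched call with $r(i_p)\le j$, and $i_{p+1}=i_p+1$ otherwise (for $i=j$ it is the one-element sequence). $\mathrm{NWTL}$ formulas: $\top\mid a\ (a\in\Sigma)\mid \mathit{call}\mid\mathit{ret}\mid\neg\phi\mid\phi\vee\phi'\mid\bigcirc\phi\mid\bigcirc_\mu\phi\mid\ominus\phi\mid\ominus_\mu\phi\mid\phi\,\mathbf{U}^\sigma\phi'\mid\phi\,\mathbf{S}^\sigma\phi'$. Semantics at position $i$ of $\bar w$: $a$ holds iff $i$ is labelled $a$; $\mathit{call}$ (resp. $\mathit{ret}$) iff $\mathit{call}(i)$ (resp. $\mathit{ret}(i)$); Boolean connectives as usual; $\bigcirc\phi$ iff $\phi$ holds at $i+1$; $\bigcirc_\mu\phi$ iff $i$ is a call with some $j$ such that $\mu(i,j)$ and $\phi$ holds at $j$; $\ominus\phi$ iff $i>1$ and $\phi$ holds at $i-1$; $\ominus_\mu\phi$ iff $i$ is a return with some $j$ such that $\mu(j,i)$ and $\phi$ holds at $j$; $\phi\,\mathbf{U}^\sigma\psi$ iff there is $j\ge i$ such that, for the summary path $i=i_0<\dots<i_k=j$, $\psi$ holds at $j$ and $\phi$ holds at $i_p$ for all $0\le p<k$; $\phi\,\mathbf{S}^\sigma\psi$ iff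 there is $j\le i$ such that, for the summary path $j=i_0<\dots<i_k=i$, $\psi$ holds at $j$ and $\phi$ holds at $i_p$ for all $0<p\le k$. -}

module Defs where

open import Level using (0ℓ)
open import Data.Nat using (ℕ; zero; suc; _≤_; _<_)
open import Data.Fin using (Fin; zero; suc)
open import Data.Product using (Σ; _×_; _,_)
open import Data.Sum using (_⊎_)
open import Data.Unit using (⊤)
open import Data.Empty using (⊥)
open import Relation.Nullary using (¬_)
open import Relation.Binary.PropositionalEquality using (_≡_)

-- Nested words over the finite alphabet Σ = Fin m.
-- Positions are natural numbers starting at 1 (as in the paper):
-- a finite nested word of length n has positions 1..n,
-- a nested ω-word has positions 1,2,3,...

data Length : Set where
  fin   : ℕ → Length
  omega : Length

InLen : Length → ℕ → Set
InLen (fin n) i = i ≤ n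
InLen omega   i = ⊤

record NestedWord (m : ℕ) : Set₁ where
  field
    len  : Length
    lab  : ℕ → Fin m           -- a_i (only meaningful at positions of the word)
    μ    : ℕ → ℕ → Set
    call : ℕ → Set
    ret  : ℕ → Set

  Pos : ℕ → Set
  Pos i = (1 ≤ i) × InLen len i

  field
    call-pos : ∀ {i} → call i → Pos i
    ret-pos  : ∀ {i} → ret i → Pos i
    μ-call : ∀ {i j} → μ i j → call i
    μ-ret  : ∀ {i j} → μ i j → ret j
    μ-<    : ∀ {i j} → μ i j → i < j
    μ-fun : ∀ {i j j'} → μ i j → μ i j' → j ≡ j'
    μ-inj : ∀ {i i' j} → μ i j → μ i' j → i ≡ i'
    μ-cover : ∀ {i j} → i ≤ j → call i → ret j →
              Σ ℕ λ k → (i ≤ k) × (k ≤ j) × (μ i k ⊎ μ k j)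

open NestedWord public

-- Summary paths.  SummaryPath w Pre Post j i holds iff the summary path
-- i = i₀ < i₁ < ... < i_k = j exists (i ≤ j) and, for every step
-- i_p → i_{p+1} (p < k), Pre holds at i_p and Post holds at i_{p+1}.

data SummaryPath {m} (w : NestedWord m) (Pre Post : ℕ → Set) (j : ℕ) : ℕ → Set where
  done  : SummaryPath w Pre Post j j
  stepμ : ∀ {i t} → Pre i → μ w i t → t ≤ j → Post t →
          SummaryPath w Pre Post j t → SummaryPath w Pre Post j i
  step1 : ∀ {i} → Pre i → ¬ (Σ ℕ λ t → μ w i t × t ≤ j) → i < j → Post (suc i) →
          SummaryPath w Pre Post j (suc i) → SummaryPath w Pre Post j i

data NWTL (m : ℕ) : Set where
  ⊤ₙ    : NWTL m
  lbl   : Fin m → NWTL m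
  callₙ : NWTL m
  retₙ  : NWTL m
  ¬ₙ_   : NWTL m → NWTL m
  _∨ₙ_  : NWTL m → NWTL m → NWTL m
  ○_    : NWTL m → NWTL m
  ○μ_   : NWTL m → NWTL m
  ⊖_    : NWTL m → NWTL m
  ⊖μ_   : NWTL m → NWTL m
  _U_   : NWTL m → NWTL m → NWTL m
  _S_   : NWTL m → NWTL m → NWTL m

-- (w , i) ⊨ φ   (meaningful for positions i of w)
_,_⊨ₙ_ : ∀ {m} → NestedWord m → ℕ → NWTL m → Set
w , i ⊨ₙ ⊤ₙ      = ⊤
w , i ⊨ₙ lbl a   = lab w i ≡ a
w , i ⊨ₙ callₙ   = call w i
w , i ⊨ₙ retₙ    = ret w i
w , i ⊨ₙ (¬ₙ φ)  = ¬ (w , i ⊨ₙ φ)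
w , i ⊨ₙ (φ ∨ₙ ψ) = (w , i ⊨ₙ φ) ⊎ (w , i ⊨ₙ ψ)
w , i ⊨ₙ (○ φ)   = Pos w (suc i) × (w , suc i ⊨ₙ φ)
w , i ⊨ₙ (○μ φ)  = call w i × (Σ ℕ λ j → μ w i j × (w , j ⊨ₙ φ))
w , zero  ⊨ₙ (⊖ φ) = ⊥
w , suc i ⊨ₙ (⊖ φ) = (1 ≤ i) × (w , i ⊨ₙ φ)
w , i ⊨ₙ (⊖μ φ)  = ret w i × (Σ ℕ λ j → μ w j i × (w , j ⊨ₙ φ))
w , i ⊨ₙ (φ U ψ) = Σ ℕ λ j → (i ≤ j) × Pos w j × (w , j ⊨ₙ ψ) ×
                     SummaryPath w (λ k → w , k ⊨ₙ φ) (λ _ → ⊤) j i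
w , i ⊨ₙ (φ S ψ) = Σ ℕ λ j → (j ≤ i) × Pos w j × (w , j ⊨ₙ ψ) ×
                     SummaryPath w (λ _ → ⊤) (λ k → w , k ⊨ₙ φ) i j

data FO (m : ℕ) (n : ℕ) : Set where
  P      : Fin m → Fin n → FO m n
  _≐_    : Fin n → Fin n → FO m n
  _<ᶠ_   : Fin n → Fin n → FO m n
  μᶠ     : Fin n → Fin n → FO m n
  callᶠ  : Fin n → FO m n
  retᶠ   : Fin n → FO m n
  ¬ᶠ_    : FO m n → FO m n
  _∨ᶠ_   : FO m n → FO m n → FO m n
  ∃ᶠ     : FO m (suc n) → FO m n

extend : ∀ {n} → ℕ → (Fin n → ℕ) → Fin (suc n) → ℕ
extend i ρ zero    = i
extend i ρ (suc x) = ρ x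

_⊨ᶠ_[_] : ∀ {m n} → NestedWord m → FO m n → (Fin n → ℕ) → Set
w ⊨ᶠ P a x [ ρ ]     = lab w (ρ x) ≡ a
w ⊨ᶠ (x ≐ y) [ ρ ]   = ρ x ≡ ρ y
w ⊨ᶠ (x <ᶠ y) [ ρ ]  = ρ x < ρ y
w ⊨ᶠ μᶠ x y [ ρ ]    = μ w (ρ x) (ρ y)
w ⊨ᶠ callᶠ x [ ρ ]   = call w (ρ x)
w ⊨ᶠ retᶠ x [ ρ ]    = ret w (ρ x)
w ⊨ᶠ (¬ᶠ φ) [ ρ ]    = ¬ (w ⊨ᶠ φ [ ρ ])
w ⊨ᶠ (φ ∨ᶠ ψ) [ ρ ]  = (w ⊨ᶠ φ [ ρ ]) ⊎ (w ⊨ᶠ ψ [ ρ ])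
w ⊨ᶠ ∃ᶠ φ [ ρ ]      = Σ ℕ λ i → Pos w i × (w ⊨ᶠ φ [ extend i ρ ])

at : ℕ → Fin 1 → ℕ
at i _ = i

{-# OPTIONS --safe #-}
module Submission where

-- FO → NWTL is the substantial direction. A nested word is a binary tree: the interior of
-- a matched call is its left subtree, the rest of its level its right subtree. Summary paths
-- without exits are exactly the downward paths of this tree, so U^σ and S^σ provide until
-- and since along branches. By induction on a first-order formula, its truth in a word with
-- marked positions is computed bottom-up by a finite algebra on this tree; quantification
-- takes the set of values obtained by placing one more mark. In each algebra the
-- transformations induced by contexts without marks are aperiodic (g^k = g^(k+1)), and
-- values of subtrees without marks are definable in NWTL. Both are preserved by
-- quantification: aperiodicity by a factorisation argument, definability because the value
-- of a tree with one mark is that of the marked node, transformed by the contexts met on the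
-- branch to it, and aperiodic products along branches are definable with until and since.
-- The last point is a branching version of Wilke's proof that counter-free automata are
-- expressible in temporal logic.

open import Defs
open import Level using (0ℓ)
open import Axiom.ExcludedMiddle using (ExcludedMiddle)
open import Data.Bool.Base using (Bool; true; false; not; _∨_; _∧_)
open import Data.Empty using (⊥; ⊥-elim)
open import Data.Fin using (Fin; zero; suc; punchIn; punchOut)
open import Data.Fin.Properties using (punchIn-punchOut)
open import Data.List.Base as List using (List; []; _∷_; length; filter; cartesianProduct; cartesianProductWith; allFin)
open import Data.List.Membership.Propositional using (_∈_; lose)
open import Data.List.Membership.Propositional.Properties using (∈-allFin; ∈-cartesianProduct⁺; ∈-cartesianProductWith⁺; ∈-map⁻; ∈-map⁺; ∈-filter⁻; ∈-filter⁺)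
open import Data.List.Properties using (filter-notAll)
open import Data.List.Relation.Unary.Any using (here; there; index)
open import Data.List.Relation.Unary.Any.Properties using (lookup-index)
open import Data.Nat using (ℕ; zero; suc; _+_; _≤_; _<_; z≤n; s≤s; _≟_)
open import Data.Nat.Properties hiding (_≟_)
open import Data.Product using (Σ; _×_; _,_; proj₁; proj₂)
open import Data.Sum using (_⊎_; inj₁; inj₂; map)
open import Data.Unit using (⊤; tt)
open import Data.Vec.Base as Vec using (Vec; []; _∷_; tabulate; replicate; lookup)
open import Data.Vec.Properties using (lookup∘tabulate; tabulate-cong; tabulate∘lookup; lookup-replicate)
open import Function.Base using (_∘_; id)
open import Function.Bundles using (_⇔_; mk⇔; Equivalence)
open import Relation.Binary.Definitions using (tri<; tri≈; tri>)
open import Relation.Binary.PropositionalEquality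
open import Relation.Nullary using (¬_; Dec; yes; no)
open import Relation.Nullary.Decidable using (decidable-stable; does; dec-true; dec-false; does-⇔)

open Equivalence using (to; from)

-- Two features of the trees shape the proof. Subtrees may be infinite, so the node equations of an
-- algebra do not determine its values: for a flag saying that some node below is marked, the
-- constant value true also satisfies them along an infinite unmarked branch. Values are therefore
-- given by their meaning, and the equations are used only along the finite branch from a node down
-- to a mark. This is also why finite words and omega-words can be treated alike. Secondly, a node
-- has one parent but up to two children: the past is linear, the future branches. Whatever belongs
-- to an edge is therefore read at its target by looking back, and the until operator only has to
-- choose a branch. The subtrees hanging off that branch enter through the letters of its edges, so
-- the definability of unmarked values has to be part of the induction.

private variable
  m n : ℕ

-- Summary paths

-- That arcs do not cross is not an axiom: it comes from the covering condition applied to the call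
-- `i'` and the return `j`. Its second alternative would put the call of `j` at or after `i'`, but
-- that call is `i`.
μ-nested : (w : NestedWord m) → ∀ {i j i' j'} → μ w i j → μ w i' j' → i < i' → i' < j → j' < j
μ-nested w p q i<i' i'<j with μ-cover w (<⇒≤ i'<j) (μ-call w q) (μ-ret w p)
... | k , _ , k≤j , inj₁ r = ≤∧≢⇒< (subst (_≤ _) (μ-fun w r q) k≤j)
        λ { refl → <-irrefl (μ-inj w p q) i<i' }
... | k , i'≤k , _ , inj₂ r = ⊥-elim (<-irrefl (sym (μ-inj w r p)) (<-≤-trans i<i' i'≤k))

pos-≤ : (w : NestedWord m) → ∀ {i j} → 1 ≤ i → i ≤ j → Pos w j → Pos w i
pos-≤ w 1≤i i≤j (_ , l) = 1≤i , go (len w) i≤j l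
  where
  go : ∀ ℓ {i j} → i ≤ j → InLen ℓ j → InLen ℓ i
  go (fin n) i≤j j≤n = ≤-trans i≤j j≤n
  go omega   _   _   = tt

-- The positions on the summary path from `i` to `j`, described without recursion by the arcs that
-- the path jumps over. This form is first-order.
Visible : NestedWord m → ℕ → ℕ → ℕ → Set
Visible w i j k = i ≤ k × k ≤ j ×
  ¬ (Σ ℕ λ c → Σ ℕ λ r → μ w c r × i ≤ c × c < k × k < r × r ≤ j)

visible-start : (w : NestedWord m) → ∀ {i j} → i ≤ j → Visible w i j i
visible-start w i≤j = ≤-refl , i≤j , λ { (c , _ , _ , i≤c , c<i , _) → <⇒≱ c<i i≤c }

-- Arcs starting strictly between `i` and `t` close before `t` by nesting, so they hide nothing from
-- `t` on.
visible-jump : (w : NestedWord m) → ∀ {i j t k} → μ w i t → t ≤ j → Visible w t j k → Visible w i j k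
visible-jump w {i} {j} {t} {k} p t≤j (t≤k , k≤j , ¬h) =
  ≤-trans (<⇒≤ (μ-< w p)) t≤k , k≤j , hidden
  where
  hidden : ¬ (Σ ℕ λ c → Σ ℕ λ r → μ w c r × i ≤ c × c < k × k < r × r ≤ j)
  hidden (c , r , q , i≤c , c<k , k<r , r≤j) with <-cmp i c
  ... | tri≈ _ refl _ = <⇒≱ k<r (subst (_≤ k) (μ-fun w p q) t≤k)
  ... | tri> _ _ c<i = <⇒≱ c<i i≤c
  ... | tri< i<c _ _ with <-cmp c t
  ...   | tri< c<t _ _ = <⇒≱ (<-≤-trans (μ-nested w p q i<c c<t) t≤k) (<⇒≤ k<r)
  ...   | tri≈ _ refl _ = ¬h (c , r , q , ≤-refl , c<k , k<r , r≤j)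
  ...   | tri> _ _ t<c = ¬h (c , r , q , <⇒≤ t<c , c<k , k<r , r≤j)

visible-next : (w : NestedWord m) → ∀ {i j k} → ¬ (Σ ℕ λ t → μ w i t × t ≤ j) →
               Visible w (suc i) j k → Visible w i j k
visible-next w {i} {j} {k} ¬t (i<k , k≤j , ¬h) = <⇒≤ i<k , k≤j , hidden
  where
  hidden : ¬ (Σ ℕ λ c → Σ ℕ λ r → μ w c r × i ≤ c × c < k × k < r × r ≤ j)
  hidden (c , r , q , i≤c , c<k , k<r , r≤j) with m≤n⇒m<n∨m≡n i≤c
  ... | inj₁ i<c  = ¬h (c , r , q , i<c , c<k , k<r , r≤j)
  ... | inj₂ refl = ¬t (r , q , r≤j)

visible-tail : (w : NestedWord m) → ∀ {i j t k} → i ≤ t → t ≤ k → Visible w i j k → Visible w t j k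
visible-tail w i≤t t≤k (_ , k≤j , ¬h) =
  t≤k , k≤j , λ { (c , r , q , t≤c , z) → ¬h (c , r , q , ≤-trans i≤t t≤c , z) }

module _ (w : NestedWord m) {Pre Post : ℕ → Set} {j : ℕ} where

  summary-visible : ∀ {i} → SummaryPath w Pre Post j i →
                    ∀ k → Visible w i j k → (k < j → Pre k) × (i < k → Post k)
  summary-visible done k (i≤k , k≤j , _) =
    (λ k<j → ⊥-elim (<⇒≱ k<j i≤k)) , (λ j<k → ⊥-elim (<⇒≱ j<k k≤j))
  summary-visible (stepμ {i} {t} pre p t≤j post π) k v@(i≤k , k≤j , ¬h) with m≤n⇒m<n∨m≡n i≤k
  ... | inj₂ refl = (λ _ → pre) , λ i<i → ⊥-elim (<-irrefl refl i<i)
  ... | inj₁ i<k with <-cmp k t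
  ...   | tri< k<t _ _ = ⊥-elim (¬h (i , t , p , ≤-refl , i<k , k<t , t≤j))
  ...   | tri≈ _ refl _ = proj₁ (summary-visible π k (visible-tail w i≤k ≤-refl v)) , λ _ → post
  ...   | tri> _ _ t<k with summary-visible π k (visible-tail w (<⇒≤ (μ-< w p)) (<⇒≤ t<k) v)
  ...     | a , b = a , λ _ → b t<k
  summary-visible (step1 {i} pre _ i<j post π) k v@(i≤k , _) with m≤n⇒m<n∨m≡n i≤k
  ... | inj₂ refl = (λ _ → pre) , λ i<i → ⊥-elim (<-irrefl refl i<i)
  ... | inj₁ i<k with summary-visible π k (visible-tail w (n≤1+n i) i<k v) | m≤n⇒m<n∨m≡n i<k
  ...   | a , b | inj₁ si<k  = a , λ _ → b si<k
  ...   | a , b | inj₂ refl = a , λ _ → post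

  -- The path is built from the left; excluded middle decides whether the return of the current
  -- position lies within the interval. The bound `d` on the remaining distance drives the
  -- recursion, as a jump has no fixed length.
  visible-summary : ExcludedMiddle 0ℓ → ∀ {i} → i ≤ j →
                    (∀ k → Visible w i j k → (k < j → Pre k) × (i < k → Post k)) →
                    SummaryPath w Pre Post j i
  visible-summary em {i} i≤j = go j (m≤n+m j i) i≤j
    where
    go : ∀ d {i} → j ≤ i + d → i ≤ j →
         (∀ k → Visible w i j k → (k < j → Pre k) × (i < k → Post k)) →
         SummaryPath w Pre Post j i
    go d {i} b i≤j h with m≤n⇒m<n∨m≡n i≤j
    go d b i≤j h | inj₂ refl = done
    go zero {i} b i≤j h | inj₁ i<j = ⊥-elim (<⇒≱ i<j (subst (j ≤_) (+-identityʳ i) b))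
    go (suc d) {i} b i≤j h | inj₁ i<j with em {Σ ℕ λ t → μ w i t × t ≤ j}
    ... | yes (t , p , t≤j) =
      stepμ (proj₁ (h i (visible-start w i≤j)) i<j) p t≤j
        (proj₂ (h t (visible-jump w p t≤j (visible-start w t≤j))) i<t)
        (go d (≤-trans (subst (j ≤_) (+-suc i d) b) (+-monoˡ-≤ d i<t)) t≤j
          λ k v → let v' = visible-jump w p t≤j v ; a , b = h k v' in
                  a , λ t<k → b (<-trans i<t t<k))
      where i<t = μ-< w p
    ... | no ¬t =
      step1 (proj₁ (h i (visible-start w i≤j)) i<j) ¬t i<j
        (proj₂ (h (suc i) (visible-next w ¬t (visible-start w i<j))) ≤-refl)
        (go d (subst (j ≤_) (+-suc i d) b) i<j
          λ k v → let a , b = h k (visible-next w ¬t v) in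
                  a , λ si<k → b (<-trans ≤-refl si<k))

-- From NWTL to FO

module Translation (em : ExcludedMiddle 0ℓ) {m : ℕ} where

  -- A formula bundled with its meaning, so that translations are composed by meaning and the
  -- equivalences come along. Variables are confined to positions, the only values that quantifiers
  -- reach.
  record FDef (n : ℕ) (A : NestedWord m → (Fin n → ℕ) → Set) : Set₁ where
    constructor _⟨_⟩
    field
      formula : FO m n
      defines : ∀ w ρ → (∀ x → Pos w (ρ x)) → (w ⊨ᶠ formula [ ρ ]) ⇔ A w ρ

  fresp : ∀ {n A B} → FDef n A → (∀ w ρ → (∀ x → Pos w (ρ x)) → A w ρ ⇔ B w ρ) → FDef n B
  fresp (φ ⟨ c ⟩) h = φ ⟨ (λ w ρ p →
    mk⇔ (to (h w ρ p) ∘ to (c w ρ p)) (from (c w ρ p) ∘ from (h w ρ p))) ⟩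

  fnot : ∀ {n A} → FDef n A → FDef n (λ w ρ → ¬ A w ρ)
  fnot (φ ⟨ c ⟩) = (¬ᶠ φ) ⟨ (λ w ρ p → mk⇔ (λ k → k ∘ from (c w ρ p)) (λ k → k ∘ to (c w ρ p))) ⟩

  for : ∀ {n A B} → FDef n A → FDef n B → FDef n (λ w ρ → A w ρ ⊎ B w ρ)
  for (φ ⟨ c ⟩) (ψ ⟨ d ⟩) = (φ ∨ᶠ ψ) ⟨ (λ w ρ p →
    mk⇔ (map (to (c w ρ p)) (to (d w ρ p))) (map (from (c w ρ p)) (from (d w ρ p)))) ⟩

  fand : ∀ {n A B} → FDef n A → FDef n B → FDef n (λ w ρ → A w ρ × B w ρ)
  fand f g = fresp (fnot (for (fnot f) (fnot g)))
    (λ w ρ _ → mk⇔ (λ k → decidable-stable em (k ∘ inj₁) , decidable-stable em (k ∘ inj₂))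
                   (λ { (a , b) (inj₁ ¬a) → ¬a a ; (a , b) (inj₂ ¬b) → ¬b b }))

  fex : ∀ {n A} → FDef (suc n) A → FDef n (λ w ρ → Σ ℕ λ i → Pos w i × A w (extend i ρ))
  fex (φ ⟨ c ⟩) = ∃ᶠ φ ⟨ (λ w ρ p →
    mk⇔ (λ (i , q , h) → i , q , to (c w _ (ext w p q)) h)
        (λ (i , q , h) → i , q , from (c w _ (ext w p q)) h)) ⟩
    where
    ext : ∀ {n} (w : NestedWord m) {ρ : Fin n → ℕ} {i} →
          (∀ x → Pos w (ρ x)) → Pos w i → ∀ x → Pos w (extend i ρ x)
    ext w p q zero    = q
    ext w p q (suc x) = p x

  fatom : ∀ {n} (φ : FO m n) → FDef n (λ w ρ → w ⊨ᶠ φ [ ρ ])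
  fatom φ = φ ⟨ (λ _ _ _ → mk⇔ id id) ⟩

  fle : ∀ {n} (x y : Fin n) → FDef n (λ w ρ → ρ x ≤ ρ y)
  fle x y = fresp (fnot (fatom (y <ᶠ x))) (λ _ _ _ → mk⇔ ≮⇒≥ ≤⇒≯)

  fsuc : ∀ {n} (x y : Fin n) → FDef n (λ w ρ → ρ y ≡ suc (ρ x))
  fsuc x y = fresp
    (fand (fatom (x <ᶠ y)) (fnot (fex (fand (fatom (suc x <ᶠ zero)) (fatom (zero <ᶠ suc y))))))
    (λ w ρ p → mk⇔
      (λ (x<y , ¬b) → sym (≤∧≮⇒≡ x<y λ sx<y → ¬b (suc (ρ x) ,
         pos-≤ w (s≤s z≤n) (<⇒≤ sx<y) (p y) , ≤-refl , sx<y)))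
      (λ e → ≤-reflexive (sym e) , λ (i , _ , x<i , i<y) → <⇒≱ x<i (≤-pred (subst (i <_) e i<y))))

  fvisible : ∀ {n} (x y z : Fin n) → FDef n (λ w ρ → Visible w (ρ x) (ρ y) (ρ z))
  fvisible x y z = fresp
    (fand (fle x z) (fand (fle z y) (fnot (fex (fex
      (fand (fatom (μᶠ (suc zero) zero)) (fand (fle (suc (suc x)) (suc zero))
        (fand (fatom (suc zero <ᶠ suc (suc z))) (fand (fatom (suc (suc z) <ᶠ zero))
          (fle zero (suc (suc y))))))))))))
    (λ w ρ _ → mk⇔
      (λ (a , b , ¬h) → a , b , λ (c , r , q , h) →
         ¬h (c , call-pos w (μ-call w q) , r , ret-pos w (μ-ret w q) , q , h))
      (λ (a , b , ¬h) → a , b , λ (c , _ , r , _ , h) → ¬h (c , r , h)))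

  fall : ∀ {n A B} → FDef (suc n) A → FDef (suc n) B →
         FDef n (λ w ρ → ∀ i → Pos w i → A w (extend i ρ) → B w (extend i ρ))
  fall f g = fresp (fnot (fex (fand f (fnot g))))
    (λ w ρ _ → mk⇔ (λ k i q a → decidable-stable em λ ¬b → k (i , q , a , ¬b))
                   (λ k (i , q , a , ¬b) → ¬b (k i q a)))

  -- Stated for any variable, since the operators evaluate their arguments at a freshly bound
  -- position.
  toFO : ∀ {n} (φ : NWTL m) (x : Fin n) → FDef n (λ w ρ → w , ρ x ⊨ₙ φ)
  toFO ⊤ₙ x       = fresp (fatom (x ≐ x)) (λ _ _ _ → mk⇔ (λ _ → tt) (λ _ → refl))
  toFO (lbl a) x  = fatom (P a x)
  toFO callₙ x    = fatom (callᶠ x)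
  toFO retₙ x     = fatom (retᶠ x)
  toFO (¬ₙ φ) x   = fnot (toFO φ x)
  toFO (φ ∨ₙ ψ) x = for (toFO φ x) (toFO ψ x)
  toFO (○ φ) x    = fresp
    (fex (fand (fsuc (suc x) zero) (toFO φ zero)))
    (λ w ρ _ → mk⇔ (λ { (_ , q , refl , h) → q , h }) (λ (q , h) → _ , q , refl , h))
  toFO (○μ φ) x   = fresp
    (fex (fand (fatom (μᶠ (suc x) zero)) (toFO φ zero)))
    (λ w ρ _ → mk⇔ (λ (j , _ , q , h) → μ-call w q , j , q , h)
                   (λ (_ , j , q , h) → j , ret-pos w (μ-ret w q) , q , h))
  toFO (⊖ φ) x    = fresp
    (fex (fand (fsuc zero (suc x)) (toFO φ zero)))
    (λ w ρ p → correct w (ρ x) (p x))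
    where
    correct : ∀ w k → Pos w k → (Σ ℕ λ i → Pos w i × (k ≡ suc i) × (w , i ⊨ₙ φ)) ⇔ (w , k ⊨ₙ (⊖ φ))
    correct w zero    _ = mk⇔ (λ { (_ , _ , () , _) }) λ ()
    correct w (suc k) p = mk⇔ (λ { (_ , q , refl , h) → proj₁ q , h })
                            (λ { (q , h) → k , pos-≤ w q (n≤1+n k) p , refl , h })
  toFO (⊖μ φ) x   = fresp
    (fex (fand (fatom (μᶠ zero (suc x))) (toFO φ zero)))
    (λ w ρ _ → mk⇔ (λ (j , _ , q , h) → μ-ret w q , j , q , h)
                   (λ (_ , j , q , h) → j , call-pos w (μ-call w q) , q , h))
  -- The recursion along the path becomes a quantifier over the visible positions before `j`.
  toFO (φ U ψ) x  = fresp
    (fex (fand (fle (suc x) zero) (fand (toFO ψ zero)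
      (fall (fand (fvisible (suc (suc x)) (suc zero) zero) (fatom (zero <ᶠ suc zero))) (toFO φ zero)))))
    (λ w ρ p → mk⇔
      (λ (j , q , i≤j , h , k) → j , i≤j , q , h , visible-summary w em i≤j
         λ l v → (λ l<j → k l (pos-≤ w (≤-trans (proj₁ (p x)) (proj₁ v)) (proj₁ (proj₂ v)) q) (v , l<j)) , _)
      (λ (j , i≤j , q , h , π) → j , q , i≤j , h , λ l _ (v , l<j) → proj₁ (summary-visible w π l v) l<j))
  toFO (φ S ψ) x  = fresp
    (fex (fand (fle zero (suc x)) (fand (toFO ψ zero)
      (fall (fand (fvisible (suc zero) (suc (suc x)) zero) (fatom (suc zero <ᶠ zero))) (toFO φ zero)))))
    (λ w ρ p → mk⇔
      (λ (j , q , j≤i , h , k) → j , j≤i , q , h , visible-summary w em j≤i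
         λ l v → _ , λ j<l → k l (pos-≤ w (≤-trans (proj₁ q) (proj₁ v)) (proj₁ (proj₂ v)) (p x)) (v , j<l))
      (λ (j , j≤i , q , h , π) → j , q , j≤i , h , λ l _ (v , j<l) → proj₂ (summary-visible w π l v) j<l))

-- Definability in NWTL

record Finite (X : Set) : Set where
  field
    elems    : List X
    complete : ∀ x → x ∈ elems

open Finite

finite-Bool : Finite Bool
finite-Bool .elems = false ∷ true ∷ []
finite-Bool .complete false = here refl
finite-Bool .complete true  = there (here refl)

finite-Fin : ∀ n → Finite (Fin n)
finite-Fin n = record { elems = allFin n ; complete = ∈-allFin }

finite-× : ∀ {X Y} → Finite X → Finite Y → Finite (X × Y)
finite-× F G .elems = cartesianProduct (elems F) (elems G)
finite-× F G .complete (x , y) = ∈-cartesianProduct⁺ (complete F x) (complete G y)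

finite-Vec : ∀ {X} → Finite X → ∀ n → Finite (Vec X n)
finite-Vec F zero .elems = [] ∷ []
finite-Vec F zero .complete [] = here refl
finite-Vec F (suc n) .elems = cartesianProductWith _∷_ (elems F) (elems (finite-Vec F n))
finite-Vec F (suc n) .complete (x ∷ v) =
  ∈-cartesianProductWith⁺ _∷_ (complete F x) (complete (finite-Vec F n) v)

-- Functions on a finite type as vectors: pointwise equal functions have equal tables, and the
-- tables form a finite type.
Table : ∀ {X} → Finite X → Set → Set
Table F Y = Vec Y (length (elems F))

module _ {X Y : Set} (F : Finite X) where

  table : (X → Y) → Table F Y
  table f = tabulate (f ∘ List.lookup (elems F))

  apply : Table F Y → X → Y
  apply t x = Vec.lookup t (index (complete F x))

  apply-table : ∀ f x → apply (table f) x ≡ f x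
  apply-table f x = trans (lookup∘tabulate (f ∘ List.lookup (elems F)) (index (complete F x)))
                          (cong f (sym (lookup-index (complete F x))))

  table-cong : ∀ {f g : X → Y} → (∀ x → f x ≡ g x) → table f ≡ table g
  table-cong e = tabulate-cong (e ∘ List.lookup (elems F))

iter : {X : Set} → ℕ → (X → X) → X → X
iter zero    g s = s
iter (suc k) g s = g (iter k g s)

iter-suc : {X : Set} (g : X → X) → ∀ k s → iter k g (g s) ≡ g (iter k g s)
iter-suc g zero    s = refl
iter-suc g (suc k) s = cong g (iter-suc g k s)

module Definability (em : ExcludedMiddle 0ℓ) {m : ℕ} where

  Pred : Set₁
  Pred = NestedWord m → ℕ → Set

  record Def (A : Pred) : Set₁ where
    constructor _⟨_⟩
    field
      formula : NWTL m
      defines : ∀ w i → Pos w i → (w , i ⊨ₙ formula) ⇔ A w i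

  dresp : ∀ {A B} → Def A → (∀ w i → Pos w i → A w i ⇔ B w i) → Def B
  dresp (φ ⟨ c ⟩) h = φ ⟨ (λ w i p → mk⇔ (to (h w i p) ∘ to (c w i p)) (from (c w i p) ∘ from (h w i p))) ⟩

  dtrue : Def (λ _ _ → ⊤)
  dtrue = ⊤ₙ ⟨ (λ _ _ _ → mk⇔ id id) ⟩

  dnot : ∀ {A} → Def A → Def (λ w i → ¬ A w i)
  dnot (φ ⟨ c ⟩) = (¬ₙ φ) ⟨ (λ w i p → mk⇔ (λ k → k ∘ from (c w i p)) (λ k → k ∘ to (c w i p))) ⟩

  dor : ∀ {A B} → Def A → Def B → Def (λ w i → A w i ⊎ B w i)
  dor (φ ⟨ c ⟩) (ψ ⟨ d ⟩) = (φ ∨ₙ ψ) ⟨ (λ w i p →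
    mk⇔ (map (to (c w i p)) (to (d w i p))) (map (from (c w i p)) (from (d w i p)))) ⟩

  dand : ∀ {A B} → Def A → Def B → Def (λ w i → A w i × B w i)
  dand f g = dresp (dnot (dor (dnot f) (dnot g)))
    (λ w i _ → mk⇔ (λ k → decidable-stable em (k ∘ inj₁) , decidable-stable em (k ∘ inj₂))
                   (λ { (a , b) (inj₁ ¬a) → ¬a a ; (a , b) (inj₂ ¬b) → ¬b b }))

  dimp : ∀ {A B} → Def A → Def B → Def (λ w i → A w i → B w i)
  dimp f g = dresp (dnot (dand f (dnot g)))
    (λ w i _ → mk⇔ (λ k a → decidable-stable em λ ¬b → k (a , ¬b)) (λ k (a , ¬b) → ¬b (k a)))

  -- `X` does not depend on the word, so excluded middle picks the formula once and for all.
  dconst : ∀ X → Def (λ _ _ → X)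
  dconst X with em {X}
  ... | yes x = dresp dtrue (λ _ _ _ → mk⇔ (λ _ → x) (λ _ → tt))
  ... | no ¬x = dresp (dnot dtrue) (λ _ _ _ → mk⇔ (λ k → ⊥-elim (k tt)) (λ x → ⊥-elim (¬x x)))

  dassume : ∀ {X A} → (X → Def A) → Def (λ w i → X → A w i)
  dassume {X} f with em {X}
  ... | yes x = dresp (f x) (λ _ _ _ → mk⇔ (λ a _ → a) (λ k → k x))
  ... | no ¬x = dresp dtrue (λ _ _ _ → mk⇔ (λ _ x → ⊥-elim (¬x x)) (λ _ → tt))

  module _ {X : Set} {A : X → Pred} where

    dex-list : ∀ xs → (∀ x → Def (A x)) → Def (λ w i → Σ X λ x → x ∈ xs × A x w i)
    dex-list [] f = dresp (dconst ⊥) (λ _ _ _ → mk⇔ (λ ()) (λ ()))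
    dex-list (x ∷ xs) f = dresp (dor (f x) (dex-list xs f))
      (λ w i _ → mk⇔ (λ { (inj₁ a) → x , here refl , a ; (inj₂ (y , y∈ , a)) → y , there y∈ , a })
                     (λ { (_ , here refl , a) → inj₁ a ; (y , there y∈ , a) → inj₂ (y , y∈ , a) }))

    dex : Finite X → (∀ x → Def (A x)) → Def (λ w i → Σ X λ x → A x w i)
    dex F f = dresp (dex-list (elems F) f)
      (λ w i _ → mk⇔ (λ (x , _ , a) → x , a) (λ (x , a) → x , complete F x , a))

  dall : ∀ {X : Set} {A : X → Pred} → Finite X → (∀ x → Def (A x)) → Def (λ w i → ∀ x → A x w i)
  dall F f = dresp (dnot (dex F (λ x → dnot (f x))))
    (λ w i _ → mk⇔ (λ k x → decidable-stable em λ ¬a → k (x , ¬a)) (λ k (x , ¬a) → ¬a (k x)))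

-- `α` is required at every node except the source, so that the label of an edge can be a property
-- of its target. Growing at the far end suits unique parents: read backwards, a path is forced.
data Path (E : ℕ → ℕ → Set) (α : ℕ → Set) (x : ℕ) : ℕ → Set where
  []   : Path E α x x
  snoc : ∀ {y z} → Path E α x y → E y z → α z → Path E α x z

module _ {E : ℕ → ℕ → Set} {α : ℕ → Set} where

  path-++ : ∀ {x y z} → Path E α x y → Path E α y z → Path E α x z
  path-++ p []           = p
  path-++ p (snoc q e a) = snoc (path-++ p q) e a

  path-cons : ∀ {x y z} → E x y → α y → Path E α y z → Path E α x z
  path-cons e a p = path-++ (snoc [] e a) p

  path-map : ∀ {E′ β} → (∀ {x y} → E x y → E′ x y) → (∀ {x y} → E x y → α y → β y) →
             ∀ {x y} → Path E α x y → Path E′ β x y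
  path-map f g []           = []
  path-map f g (snoc p e a) = snoc (path-map f g p) (f e) (g e a)

-- Aperiodic products along branches

module Kamp (em : ExcludedMiddle 0ℓ) {m : ℕ} where

  open Definability em {m}

  -- A graph with unique parents on which next, previous, until and since are expressible. Until
  -- quantifies over branches. The notion is abstract because the induction passes to subgraphs and
  -- contractions of the tree.
  record EdgeSystem : Set₁ where
    field
      E             : NestedWord m → ℕ → ℕ → Set
      source-pos    : ∀ w {x y} → E w x y → Pos w x
      target-pos    : ∀ w {x y} → E w x y → Pos w y
      parent-unique : ∀ w {x y z} → E w x z → E w y z → x ≡ y
      dnext  : ∀ {β} → Def β → Def (λ w x → Σ ℕ λ y → E w x y × β w y)
      dprev  : ∀ {β} → Def β → Def (λ w y → Σ ℕ λ x → E w x y × β w x)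
      duntil : ∀ {α β} → Def α → Def β → Def (λ w x → Σ ℕ λ y → Path (E w) (α w) x y × β w y)
      dsince : ∀ {α β} → Def α → Def β → Def (λ w y → Σ ℕ λ x → Path (E w) (α w) x y × β w x)

    path-source-pos : ∀ w {α : ℕ → Set} {x y} → Pos w y → Path (E w) α x y → Pos w x
    path-source-pos w q []           = q
    path-source-pos w q (snoc p e _) = path-source-pos w (source-pos w e) p

    path-target-pos : ∀ w {α : ℕ → Set} {x y} → Pos w x → Path (E w) α x y → Pos w y
    path-target-pos w q []           = q
    path-target-pos w q (snoc p e _) = target-pos w e

  open EdgeSystem

  restrict : EdgeSystem → ∀ {γ} → Def γ → EdgeSystem
  restrict 𝓢 {γ} dγ = record
    { E             = λ w x y → E 𝓢 w x y × γ w y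
    ; source-pos    = λ w (e , _) → source-pos 𝓢 w e
    ; target-pos    = λ w (e , _) → target-pos 𝓢 w e
    ; parent-unique = λ w (e , _) (e′ , _) → parent-unique 𝓢 w e e′
    ; dnext  = λ dβ → dresp (dnext 𝓢 (dand dγ dβ)) λ w x _ →
        mk⇔ (λ (y , e , c , b) → y , (e , c) , b) (λ (y , (e , c) , b) → y , e , c , b)
    ; dprev  = λ dβ → dresp (dand dγ (dprev 𝓢 dβ)) λ w y _ →
        mk⇔ (λ (c , x , e , b) → x , (e , c) , b) (λ (x , (e , c) , b) → c , x , e , b)
    ; duntil = λ dα dβ → dresp (duntil 𝓢 (dand dγ dα) dβ) λ w x _ →
        mk⇔ (λ (y , p , b) → y , split w p , b) (λ (y , p , b) → y , merge w p , b)
    ; dsince = λ dα dβ → dresp (dsince 𝓢 (dand dγ dα) dβ) λ w x _ →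
        mk⇔ (λ (y , p , b) → y , split w p , b) (λ (y , p , b) → y , merge w p , b)
    }
    where
    split : ∀ w {α : ℕ → Set} {x y} → Path (E 𝓢 w) (λ z → γ w z × α z) x y →
            Path (λ x y → E 𝓢 w x y × γ w y) α x y
    split w []                 = []
    split w (snoc p e (c , a)) = snoc (split w p) (e , c) a

    merge : ∀ w {α : ℕ → Set} {x y} → Path (λ x y → E 𝓢 w x y × γ w y) α x y →
            Path (E 𝓢 w) (λ z → γ w z × α z) x y
    merge w []                 = []
    merge w (snoc p (e , c) a) = snoc (merge w p) e (c , a)

  module Contract (𝓢 : EdgeSystem) {γ : Pred} (dγ : Def γ) where

    Block : NestedWord m → ℕ → ℕ → Set
    Block w = Path (E 𝓢 w) (λ z → ¬ γ w z)

    -- Consecutive `γ`-nodes of a branch become adjacent. The last edge is kept apart from the block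
    -- because it is the one carrying the letter at which runs will be cut.
    EC : NestedWord m → ℕ → ℕ → Set
    EC w x z = γ w x × Σ ℕ λ v → Block w x v × E 𝓢 w v z × γ w z

    block-unique : ∀ w {x y v} → γ w x → γ w y → Block w x v → Block w y v → x ≡ y
    block-unique w cx cy []           []             = refl
    block-unique w cx cy []           (snoc _ _ ¬c)  = ⊥-elim (¬c cx)
    block-unique w cx cy (snoc _ _ ¬c) []            = ⊥-elim (¬c cy)
    block-unique w cx cy (snoc p e _) (snoc q e′ _) with refl ← parent-unique 𝓢 w e e′ =
      block-unique w cx cy p q

    block-trivial : ∀ w {x y} → γ w y → Block w x y → x ≡ y
    block-trivial w cy []            = refl
    block-trivial w cy (snoc _ _ ¬c) = ⊥-elim (¬c cy)

    refine : ∀ w {α : ℕ → Set} {x y} → Path (EC w) α x y → Path (E 𝓢 w) (λ z → γ w z → α z) x y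
    refine w []                              = []
    refine w (snoc p (_ , v , b , e , _) a) =
      path-++ (refine w p) (snoc (path-map id (λ _ ¬c c → ⊥-elim (¬c c)) b) e λ _ → a)

    coarsen : ∀ w {α : ℕ → Set} {x y} → γ w x → Path (E 𝓢 w) (λ z → γ w z → α z) x y →
              Σ ℕ λ z → Path (EC w) α x z × Block w z y × γ w z
    coarsen w {x = x} cx [] = x , [] , [] , cx
    coarsen w cx (snoc {z = y} p e a) with coarsen w cx p | em {γ w y}
    ... | z , q , b , cz | yes cy = y , snoc q (cz , _ , b , e , cy) (a cy) , [] , cy
    ... | z , q , b , cz | no ¬cy = z , q , snoc b e ¬cy , cz

    coarsen′ : ∀ w {α : ℕ → Set} {x y} → γ w x → γ w y → Path (E 𝓢 w) (λ z → γ w z → α z) x y →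
               Path (EC w) α x y
    coarsen′ w cx cy p with coarsen w cx p
    ... | z , q , b , _ with refl ← block-trivial w cy b = q

    -- The reason for the extra disjunct in until and since after contraction: an empty path may sit
    -- outside `γ`, while any other path begins and ends in `γ`.
    ends : ∀ w {α : ℕ → Set} {x y} → Path (EC w) α x y → x ≡ y ⊎ (γ w x × γ w y)
    ends w [] = inj₁ refl
    ends w (snoc p (cy , _ , _ , _ , cz) _) with ends w p
    ... | inj₁ refl     = inj₂ (cy , cz)
    ... | inj₂ (cx , _) = inj₂ (cx , cz)

    contract : EdgeSystem
    contract = record
      { E             = EC
      ; source-pos    = λ w (_ , _ , b , e , _) → path-source-pos 𝓢 w (source-pos 𝓢 w e) b
      ; target-pos    = λ w (_ , _ , _ , e , _) → target-pos 𝓢 w e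
      ; parent-unique = unique
      ; dnext  = λ dβ → dresp (dand dγ (duntil 𝓢 (dnot dγ) (dnext 𝓢 (dand dγ dβ)))) λ w x _ →
          mk⇔ (λ (cx , v , b , z , e , cz , h) → z , (cx , v , b , e , cz) , h)
              (λ (z , (cx , v , b , e , cz) , h) → cx , v , b , z , e , cz , h)
      ; dprev  = λ dβ → dresp (dand dγ (dprev 𝓢 (dsince 𝓢 (dnot dγ) (dand dγ dβ)))) λ w z _ →
          mk⇔ (λ (cz , v , e , x , b , cx , h) → x , (cx , v , b , e , cz) , h)
              (λ (x , (cx , v , b , e , cz) , h) → cz , v , e , x , b , cx , h)
      ; duntil = λ dα dβ → dresp (dor dβ (dand dγ (duntil 𝓢 (dimp dγ dα) (dand dγ dβ)))) λ w x _ →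
          mk⇔ (λ { (inj₁ h) → x , [] , h ; (inj₂ (cx , y , p , cy , h)) → y , coarsen′ w cx cy p , h })
              (λ (y , p , h) → to-until w p h)
      ; dsince = λ dα dβ → dresp (dor dβ (dand dγ (dsince 𝓢 (dimp dγ dα) (dand dγ dβ)))) λ w y _ →
          mk⇔ (λ { (inj₁ h) → y , [] , h ; (inj₂ (cy , x , p , cx , h)) → x , coarsen′ w cx cy p , h })
              (λ (x , p , h) → to-since w p h)
      }
      where
      unique : ∀ w {x y z} → EC w x z → EC w y z → x ≡ y
      unique w (cx , v , b , e , _) (cy , v′ , b′ , e′ , _) with refl ← parent-unique 𝓢 w e e′ =
        block-unique w cx cy b b′

      module _ (w : NestedWord m) {α β : ℕ → Set} {x y : ℕ} (p : Path (EC w) α x y) where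

        to-until : β y → β x ⊎ (γ w x × Σ ℕ λ y → Path (E 𝓢 w) (λ z → γ w z → α z) x y × γ w y × β y)
        to-until h with ends w p
        ... | inj₁ refl      = inj₁ h
        ... | inj₂ (cx , cy) = inj₂ (cx , y , refine w p , cy , h)

        to-since : β x → β y ⊎ (γ w y × Σ ℕ λ x → Path (E 𝓢 w) (λ z → γ w z → α z) x y × γ w x × β x)
        to-since h with ends w p
        ... | inj₁ refl      = inj₁ h
        ... | inj₂ (cx , cy) = inj₂ (cy , x , refine w p , cx , h)

  -- States travel upwards: the letters of the edges from x to z turn r at z into s at x.
  data Run {N} (E : ℕ → ℕ → Set) {T : Set} (δ : Fin N → T → T) (Λ : Fin N → ℕ → Set)
           (x : ℕ) (s : T) : ℕ → T → Set where
    []   : Run E δ Λ x s x s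
    snoc : ∀ {y z r} a → Run E δ Λ x s y (δ a r) → E y z → Λ a z → Run E δ Λ x s z r

  run-++ : ∀ {N E T} {δ : Fin N → T → T} {Λ x s y q z r} →
           Run E δ Λ x s y q → Run E δ Λ y q z r → Run E δ Λ x s z r
  run-++ p []             = p
  run-++ p (snoc a q e l) = snoc a (run-++ p q) e l

  -- `Mon` is an aperiodic monoid, later that of the contexts. It stays fixed throughout the
  -- induction, while edges, letters and states change; closure under composition allows the
  -- transformation of a whole block to serve as a letter.
  module Transformations {T : Set} (F : Finite T) (Mon : (T → T) → Set)
    (mon-id   : Mon id)
    (mon-∘    : ∀ {g h} → Mon g → Mon h → Mon (g ∘ h))
    (mon-≗    : ∀ {g h} → (∀ s → g s ≡ h s) → Mon g → Mon h)
    (mon-aper : ∀ {g} → Mon g → Σ ℕ λ k → ∀ s → iter k g s ≡ iter (suc k) g s) where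

    -- Letters may overlap: after contraction, different tables can describe the same block. Hence
    -- `agree` asks only that they coincide on the states in `Q`.
    record Labelling (𝓢 : EdgeSystem) (Q : List T) (N : ℕ) : Set₁ where
      field
        δ      : Fin N → T → T
        Λ      : Fin N → Pred
        dΛ     : ∀ a → Def (Λ a)
        δ-mon  : ∀ a → Mon (δ a)
        δ-closed    : ∀ a {s} → s ∈ Q → δ a s ∈ Q
        total  : ∀ w {x y} → E 𝓢 w x y → Σ (Fin N) λ a → Λ a w y
        agree  : ∀ w {x y a b} → E 𝓢 w x y → Λ a w y → Λ b w y → ∀ {s} → s ∈ Q → δ a s ≡ δ b s

      RunL : NestedWord m → ℕ → T → ℕ → T → Set
      RunL w = Run (E 𝓢 w) δ (λ a → Λ a w)

      run-Q : ∀ w {x s y r} → r ∈ Q → RunL w x s y r → s ∈ Q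
      run-Q w r∈ []             = r∈
      run-Q w r∈ (snoc a p _ _) = run-Q w (δ-closed a r∈) p

      run-path : ∀ w {x s y r} → RunL w x s y r → Path (E 𝓢 w) (λ _ → ⊤) x y
      run-path w []             = []
      run-path w (snoc _ p e _) = snoc (run-path w p) e tt

      path-run : ∀ w {α : ℕ → Set} {x y} → Path (E 𝓢 w) α x y → Σ (T → T) λ g →
                 Mon g × (∀ {s} → s ∈ Q → g s ∈ Q) × (∀ s → RunL w x (g s) y s)
      path-run w [] = id , mon-id , id , λ s → []
      path-run w (snoc p e _) with path-run w p | total w e
      ... | g , mg , gS , r | a , l =
        g ∘ δ a , mon-∘ mg (δ-mon a) , gS ∘ δ-closed a , λ s → snoc a (r (δ a s)) e l

    open Labelling

    -- Aperiodicity excludes permutations other than the identity. As `g` covers `Q`, each `s` is a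
    -- `k`-fold image of a state, and for the stabilising exponent `k` one more application changes
    -- nothing.
    fixes : ∀ {Q : List T} {g} → Mon g → (∀ {s} → s ∈ Q → s ∈ List.map g Q) → ∀ {s} → s ∈ Q → g s ≡ s
    fixes {Q} {g} mg surj s∈ with mon-aper mg
    ... | k , e with preimage k s∈
      where
      preimage : ∀ k {s} → s ∈ Q → Σ T λ r → r ∈ Q × s ≡ iter k g r
      preimage zero    {s} s∈ = s , s∈ , refl
      preimage (suc k) s∈ with preimage k s∈
      ... | r , r∈ , refl with ∈-map⁻ g (surj r∈)
      ... | q , q∈ , refl = q , q∈ , iter-suc g k q
    ... | r , _ , refl = sym (e r)

    Reach : ∀ {𝓢 Q N} → Labelling 𝓢 Q N → T → T → Set₁
    Reach L s₁ s₀ = ∀ {β} → Def β →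
      Def (λ w x → Σ ℕ λ y → RunL L w x s₁ y s₀ × β w y) ×
      Def (λ w y → Σ ℕ λ x → RunL L w x s₁ y s₀ × β w x)

    module Trivial {𝓢 Q N} (L : Labelling 𝓢 Q N) (δ-id : ∀ a {s} → s ∈ Q → δ L a s ≡ s) where

      run-id : ∀ w {x s y r} → r ∈ Q → RunL L w x s y r → s ≡ r
      run-id w r∈ []             = refl
      run-id w r∈ (snoc a p _ _) = trans (run-id w (δ-closed L a r∈) p) (δ-id a r∈)

      path-run-id : ∀ w {α : ℕ → Set} {x y r} → r ∈ Q → Path (E 𝓢 w) α x y → RunL L w x r y r
      path-run-id w r∈ [] = []
      path-run-id w {x = x} {r = r} r∈ (snoc {y = y} p e _) with total L w e
      ... | a , l = snoc a (subst (RunL L w x r y) (sym (δ-id a r∈)) (path-run-id w r∈ p)) e l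

      reach : ∀ s₁ {s₀} → s₀ ∈ Q → Reach L s₁ s₀
      reach s₁ {s₀} s₀∈ dβ =
        dresp (dand (dconst (s₁ ≡ s₀)) (duntil 𝓢 dtrue dβ))
          (λ w x _ → mk⇔ (λ { (refl , y , p , b) → y , path-run-id w s₀∈ p , b })
                         (λ (y , p , b) → run-id w s₀∈ p , y , run-path L w p , b)) ,
        dresp (dand (dconst (s₁ ≡ s₀)) (dsince 𝓢 dtrue dβ))
          (λ w x _ → mk⇔ (λ { (refl , y , p , b) → y , path-run-id w s₀∈ p , b })
                         (λ (y , p , b) → run-id w s₀∈ p , y , run-path L w p , b))

    -- Cutting runs at the edges with a fixed letter

    module Step {𝓢 Q N} (L : Labelling 𝓢 Q (suc N)) (c : Fin (suc N))
      (reachB : ∀ (L′ : Labelling (restrict 𝓢 (dnot (dΛ L c))) Q N) s₁ {s₀} → s₀ ∈ Q → Reach L′ s₁ s₀)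
      where

      C : Pred
      C = Λ L c

      𝓑 : EdgeSystem
      𝓑 = restrict 𝓢 (dnot (dΛ L c))

      B : Labelling 𝓑 Q N
      B = record
        { δ     = δ L ∘ punchIn c
        ; Λ     = Λ L ∘ punchIn c
        ; dΛ    = dΛ L ∘ punchIn c
        ; δ-mon = δ-mon L ∘ punchIn c
        ; δ-closed   = δ-closed L ∘ punchIn c
        ; total = tot
        ; agree = λ w (e , _) → agree L w e
        }
        where
        tot : ∀ w {x y} → E 𝓑 w x y → Σ (Fin N) λ a → Λ L (punchIn c a) w y
        tot w {y = y} (e , ¬c) with total L w e
        ... | a , l = punchOut c≢a , subst (λ b → Λ L b w y) (sym (punchIn-punchOut c≢a)) l
          where
          c≢a : c ≢ a
          c≢a refl = ¬c l

      open Contract 𝓢 (dΛ L c)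

      image : List T
      image = List.map (δ L c) Q

      -- The image of `Q` under `c`, cut out of `Q` by a filter: `image` itself is a list as long as
      -- `Q`, and the induction is on the length.
      Q′ : List T
      Q′ = filter (λ s → em {s ∈ image}) Q

      Q′⊆Q : ∀ {s} → s ∈ Q′ → s ∈ Q
      Q′⊆Q s∈ = proj₁ (∈-filter⁻ (λ s → em {s ∈ image}) s∈)

      δc∈Q′ : ∀ {s} → s ∈ Q → δ L c s ∈ Q′
      δc∈Q′ s∈ = ∈-filter⁺ (λ s → em {s ∈ image}) (δ-closed L c s∈) (∈-map⁺ (δ L c) s∈)

      -- The state at a target of a c-edge is stored after applying c, so the
      -- transformation of a block maps r to δ c s.
      BlockMap : T → T → Pred
      BlockMap r r′ w z = Σ T λ s → r′ ≡ δ L c s × C w z ×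
        Σ ℕ λ v → E 𝓢 w v z × Σ ℕ λ x → RunL B w x s v r × C w x

      dBlockMap : ∀ {r} → r ∈ Q′ → ∀ r′ → Def (BlockMap r r′)
      dBlockMap r∈ r′ = dex F λ s → dand (dconst (r′ ≡ δ L c s)) (dand (dΛ L c)
        (dprev 𝓢 (proj₂ (reachB B s (Q′⊆Q r∈) (dΛ L c)))))

      run-block : ∀ w {x s y r} → RunL B w x s y r → Block w x y
      run-block w []                    = []
      run-block w (snoc a p (e , ¬c) l) = snoc (run-block w p) e ¬c

      -- Read from `v` upwards, a run is forced: parents are unique, and overlapping letters act
      -- alike on `Q`. No edge of `𝓑` enters a `C`-node, so both runs stop at the first one met.
      run-unique : ∀ w {x y s t v r} → C w x → C w y → r ∈ Q →
                   RunL B w x s v r → RunL B w y t v r → s ≡ t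
      run-unique w cx cy r∈ [] []                     = refl
      run-unique w cx cy r∈ [] (snoc _ _ (_ , ¬c) _)  = ⊥-elim (¬c cx)
      run-unique w cx cy r∈ (snoc _ _ (_ , ¬c) _) []  = ⊥-elim (¬c cy)
      run-unique w cx cy r∈ (snoc a p (e , _) l) (snoc b q (e′ , _) l′)
        with refl ← parent-unique 𝓢 w e e′ =
        run-unique w cx cy (δ-closed L _ r∈) p
          (subst (RunL B w _ _ _) (agree L w e l′ l r∈) q)

      blockMap-unique : ∀ w {z r r₁ r₂} → r ∈ Q′ → BlockMap r r₁ w z → BlockMap r r₂ w z → r₁ ≡ r₂
      blockMap-unique w r∈ (s , refl , _ , v , e , x , p , cx) (s′ , refl , _ , v′ , e′ , x′ , p′ , cx′)
        with refl ← parent-unique 𝓢 w e e′ = cong (δ L c) (run-unique w cx cx′ (Q′⊆Q r∈) p p′)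

      Good : (T → T) → Set
      Good g = Mon g × (∀ {s} → s ∈ Q′ → g s ∈ Q′)

      FT : Finite (Table F T)
      FT = finite-Vec F _

      -- The new letters are all tables on `T`, including any that lie outside `Mon` or leave `Q′`.
      -- The identity is a safe default for those: labels are defined from `δ′`, after the
      -- replacement, so no label claims a wrong transformation.
      goodify : (T → T) → T → T
      goodify g with em {Good g}
      ... | yes _ = g
      ... | no _  = id

      goodify-good : ∀ g → Good (goodify g)
      goodify-good g with em {Good g}
      ... | yes h = h
      ... | no _  = mon-id , id

      goodify-id : ∀ {g} → Good g → goodify g ≡ g
      goodify-id {g} h with em {Good g}
      ... | yes _ = refl
      ... | no ¬h = ⊥-elim (¬h h)

      δ′ : Fin (length (elems FT)) → T → T
      δ′ a = goodify (apply F (List.lookup (elems FT) a))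

      block-letter : ∀ w {x v z} → C w x → Block w x v → E 𝓢 w v z → C w z →
                     Σ (Fin (length (elems FT))) λ a → ∀ {r} → r ∈ Q′ → BlockMap r (δ′ a r) w z
      block-letter w {x} {v} {z} cx b e cz with path-run B w (path-map′ w b)
        where
        path-map′ : ∀ w {x v} → Block w x v → Path (E 𝓑 w) (λ _ → ⊤) x v
        path-map′ w []            = []
        path-map′ w (snoc p e ¬c) = snoc (path-map′ w p) (e , ¬c) tt
      ... | g , mg , gS , run = a , λ {r} r∈ →
        g r , δ′a≗h r , cz , v , e , x , run r , cx
        where
        h : T → T
        h = δ L c ∘ g
        a : Fin (length (elems FT))
        a = index (complete FT (table F h))
        apply≗h : ∀ r → apply F (List.lookup (elems FT) a) r ≡ h r
        apply≗h r = trans (cong (λ t → apply F t r) (sym (lookup-index (complete FT (table F h)))))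
                          (apply-table F h r)
        good : Good (apply F (List.lookup (elems FT) a))
        good = mon-≗ (sym ∘ apply≗h) (mon-∘ (δ-mon L c) mg) ,
               λ {s} s∈ → subst (_∈ Q′) (sym (apply≗h s)) (δc∈Q′ (gS (Q′⊆Q s∈)))
        δ′a≗h : ∀ r → δ′ a r ≡ h r
        δ′a≗h r = trans (cong (λ f → f r) (goodify-id good)) (apply≗h r)

      -- A letter has to be recognised at `z` alone. This is possible although the start of a block
      -- may have other continuations: the block ending at `z` is determined by `z`, and since
      -- expresses its effect on each state.
      L′ : Labelling contract Q′ (length (elems FT))
      L′ = record
        { δ     = δ′
        ; Λ     = λ a w z → ∀ r → r ∈ Q′ → BlockMap r (δ′ a r) w z
        ; dΛ    = λ a → dall F λ r → dassume λ r∈ → dBlockMap r∈ (δ′ a r)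
        ; δ-mon = λ a → proj₁ (goodify-good (apply F (List.lookup (elems FT) a)))
        ; δ-closed   = λ a → proj₂ (goodify-good (apply F (List.lookup (elems FT) a)))
        ; total = λ w (cx , v , b , e , cz) → let a , h = block-letter w cx b e cz in a , λ r → h
        ; agree = λ w _ l l′ {r} r∈ → blockMap-unique w r∈ (l r r∈) (l′ r r∈)
        }

      -- A run cut after its first and its last `c`-edge, whose targets are `x₂` and `x₃`; whole
      -- blocks lie between them. At `x₂` and `x₃` the contracted run holds the states after `c` has
      -- acted, namely `r` and `δ L c q`.
      Split : NestedWord m → ℕ → T → ℕ → T → Set
      Split w x s₁ y s₀ = Σ T λ q → Σ T λ r → Σ ℕ λ x₁ → Σ ℕ λ x₂ → Σ ℕ λ x₃ →
        RunL B w x s₁ x₁ r × E 𝓢 w x₁ x₂ × C w x₂ ×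
        RunL L′ w x₂ r x₃ (δ L c q) × C w x₃ × RunL B w x₃ q y s₀

      split : ∀ w {x s₁ y s₀} → s₀ ∈ Q → RunL L w x s₁ y s₀ → RunL B w x s₁ y s₀ ⊎ Split w x s₁ y s₀
      split w s₀∈ [] = inj₁ []
      split w {x} {s₁} {z} {s₀} s₀∈ (snoc {y = y} a p e l) with em {C w z} | split w (δ-closed L a s₀∈) p
      -- The first `c`-edge is also the last, so the contracted run is empty.
      ... | yes cz | inj₁ b =
        inj₂ (s₀ , _ , y , z , z , subst (RunL B w x s₁ y) (agree L w e l cz s₀∈) b , e , cz , [] , cz , [])
      -- The former tail `b′` and the `c`-edge after it complete a block, which becomes one more
      -- letter of the contracted run.
      ... | yes cz | inj₂ (q , r , x₁ , x₂ , x₃ , b , e₁ , c₂ , p′ , c₃ , b′)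
        with block-letter w c₃ (run-block w b′) e cz
      ...   | a′ , h with δc∈Q′ s₀∈
      ...     | δs₀∈ = inj₂ (s₀ , r , x₁ , x₂ , z , b , e₁ , c₂ ,
        snoc a′ (subst (RunL L′ w x₂ r x₃) eq p′) (c₃ , y , run-block w b′ , e , cz) (λ r → h {r}) , cz , [])
        where
        -- `block-letter` chose its letter from the path alone; uniqueness of block maps identifies
        -- its effect with that of the run.
        eq : δ L c q ≡ δ′ a′ (δ L c s₀)
        eq = blockMap-unique w δs₀∈
          (q , refl , cz , y , e , x₃ , subst (RunL B w x₃ q y) (agree L w e l cz s₀∈) b′ , c₃)
          (h δs₀∈)
      split w {x} {s₁} {z} {s₀} s₀∈ (snoc {y = y} a p e l) | no ¬cz | rec with total B w (e , ¬cz)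
      ... | a′ , l′ with agree L w e l l′ s₀∈
      split w {x} {s₁} {z} {s₀} s₀∈ (snoc {y = y} a p e l) | no ¬cz | inj₁ b | a′ , l′ | eq =
        inj₁ (snoc a′ (subst (RunL B w x s₁ y) eq b) (e , ¬cz) l′)
      split w {x} {s₁} {z} {s₀} s₀∈ (snoc {y = y} a p e l) | no ¬cz
        | inj₂ (q , r , x₁ , x₂ , x₃ , b , e₁ , c₂ , p′ , c₃ , b′) | a′ , l′ | eq =
        inj₂ (q , r , x₁ , x₂ , x₃ , b , e₁ , c₂ , p′ , c₃ ,
              snoc a′ (subst (RunL B w x₃ q y) eq b′) (e , ¬cz) l′)

      forget : ∀ w {x s y r} → RunL B w x s y r → RunL L w x s y r
      forget w []                   = []
      forget w (snoc a p (e , _) l) = snoc (punchIn c a) (forget w p) e l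

      -- A contracted run knows states only after `c` has acted. Preimages are recovered from the
      -- far end: the block map of the last block supplies the state before `c` at the preceding
      -- `C`-node.
      expand : ∀ w {x r z r′} q → r′ ≡ δ L c q → q ∈ Q → RunL L′ w x r z r′ →
               Σ T λ p → r ≡ δ L c p × RunL L w x p z q
      expand w q eq q∈ [] = q , eq , []
      expand w {x} q refl q∈ (snoc a p (cy , v , b , e , cz) l)
        with s , eq , _ , v′ , e′ , y′ , b′ , cy′ ← l (δ L c q) (δc∈Q′ q∈)
        with refl ← parent-unique 𝓢 w e e′
        with refl ← block-unique w cy cy′ b (run-block w b′)
        with p₂ , eq₂ , run ← expand w s eq (run-Q B w (δ-closed L c q∈) b′) p =
        p₂ , eq₂ , run-++ run (snoc c (forget w b′) e cz)

      unsplit : ∀ w {x s₁ y s₀} → s₀ ∈ Q → Split w x s₁ y s₀ → RunL L w x s₁ y s₀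
      unsplit w {x} {s₁} s₀∈ (q , r , x₁ , x₂ , x₃ , b , e , c₂ , p , c₃ , b′)
        with p₂ , refl , run ← expand w q refl (run-Q B w s₀∈ b′) p =
        run-++ (snoc c (forget w b) e c₂) (run-++ run (forget w b′))

      -- The pieces of a `Split` are nested in one formula, read from `x` downwards for until and
      -- from `y` upwards for since; the intermediate states range over a finite set.
      reach : (∀ s₁ {s₀} → s₀ ∈ Q′ → Reach L′ s₁ s₀) → ∀ s₁ {s₀} → s₀ ∈ Q → Reach L s₁ s₀
      reach reachC s₁ {s₀} s₀∈ {β} dβ = dresp (dor (proj₁ (reachB B s₁ s₀∈ dβ)) (dex F up)) correct-up ,
        dresp (dor (proj₂ (reachB B s₁ s₀∈ dβ)) (dex F down)) correct-down
        where
        Up Down : T → Pred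
        Up q w x = q ∈ Q × Σ T λ r → r ∈ Q × Σ ℕ λ x₁ → RunL B w x s₁ x₁ r × Σ ℕ λ x₂ → E 𝓢 w x₁ x₂ ×
          C w x₂ × Σ ℕ λ x₃ → RunL L′ w x₂ r x₃ (δ L c q) × C w x₃ × Σ ℕ λ y → RunL B w x₃ q y s₀ × β w y
        Down q w y = q ∈ Q × Σ T λ r → r ∈ Q × Σ ℕ λ x₃ → RunL B w x₃ q y s₀ × C w x₃ ×
          Σ ℕ λ x₂ → RunL L′ w x₂ r x₃ (δ L c q) × C w x₂ × Σ ℕ λ x₁ → E 𝓢 w x₁ x₂ ×
          Σ ℕ λ x → RunL B w x s₁ x₁ r × β w x

        dsuppose : ∀ {X A} → (X → Def A) → Def (λ w i → X × A w i)
        dsuppose {X} f with em {X}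
        ... | yes h = dresp (f h) (λ _ _ _ → mk⇔ (λ a → h , a) proj₂)
        ... | no ¬h = dresp (dconst ⊥) (λ _ _ _ → mk⇔ ⊥-elim (λ (h , _) → ⊥-elim (¬h h)))

        up : ∀ q → Def (Up q)
        up q = dsuppose λ q∈ → dex F λ r → dsuppose λ r∈ →
          proj₁ (reachB B s₁ r∈ (dnext 𝓢 (dand (dΛ L c)
            (proj₁ (reachC r (δc∈Q′ q∈) (dand (dΛ L c) (proj₁ (reachB B q s₀∈ dβ))))))))

        down : ∀ q → Def (Down q)
        down q = dsuppose λ q∈ → dex F λ r → dsuppose λ r∈ →
          proj₂ (reachB B q s₀∈ (dand (dΛ L c) (proj₂ (reachC r (δc∈Q′ q∈) (dand (dΛ L c)
            (dprev 𝓢 (proj₂ (reachB B s₁ r∈ dβ))))))))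

        states : ∀ w {q r x₂ x₃ y} → RunL L′ w x₂ r x₃ (δ L c q) → RunL B w x₃ q y s₀ → q ∈ Q × r ∈ Q
        states w p b = let q∈ = run-Q B w s₀∈ b in q∈ , Q′⊆Q (run-Q L′ w (δc∈Q′ q∈) p)

        correct-up : ∀ w x → Pos w x →
          ((Σ ℕ λ y → RunL B w x s₁ y s₀ × β w y) ⊎ (Σ T λ q → Up q w x)) ⇔
          (Σ ℕ λ y → RunL L w x s₁ y s₀ × β w y)
        correct-up w x _ = mk⇔
          (λ { (inj₁ (y , b , h)) → y , forget w b , h
             ; (inj₂ (q , _ , r , _ , x₁ , b , x₂ , e , c₂ , x₃ , p , c₃ , y , b′ , h)) →
               y , unsplit w s₀∈ (q , r , x₁ , x₂ , x₃ , b , e , c₂ , p , c₃ , b′) , h })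
          back
          where
          back : (Σ ℕ λ y → RunL L w x s₁ y s₀ × β w y) →
                 (Σ ℕ λ y → RunL B w x s₁ y s₀ × β w y) ⊎ (Σ T λ q → Up q w x)
          back (y , run , h) with split w s₀∈ run
          ... | inj₁ b = inj₁ (y , b , h)
          ... | inj₂ (q , r , x₁ , x₂ , x₃ , b , e , c₂ , p , c₃ , b′) =
            let q∈ , r∈ = states w p b′ in
            inj₂ (q , q∈ , r , r∈ , x₁ , b , x₂ , e , c₂ , x₃ , p , c₃ , y , b′ , h)

        correct-down : ∀ w y → Pos w y →
          ((Σ ℕ λ x → RunL B w x s₁ y s₀ × β w x) ⊎ (Σ T λ q → Down q w y)) ⇔
          (Σ ℕ λ x → RunL L w x s₁ y s₀ × β w x)
        correct-down w y _ = mk⇔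
          (λ { (inj₁ (x , b , h)) → x , forget w b , h
             ; (inj₂ (q , _ , r , _ , x₃ , b′ , c₃ , x₂ , p , c₂ , x₁ , e , x , b , h)) →
               x , unsplit w s₀∈ (q , r , x₁ , x₂ , x₃ , b , e , c₂ , p , c₃ , b′) , h })
          back
          where
          back : (Σ ℕ λ x → RunL L w x s₁ y s₀ × β w x) →
                 (Σ ℕ λ x → RunL B w x s₁ y s₀ × β w x) ⊎ (Σ T λ q → Down q w y)
          back (x , run , h) with split w s₀∈ run
          ... | inj₁ b = inj₁ (x , b , h)
          ... | inj₂ (q , r , x₁ , x₂ , x₃ , b , e , c₂ , p , c₃ , b′) =
            let q∈ , r∈ = states w p b′ in
            inj₂ (q , q∈ , r , r∈ , x₃ , b′ , c₃ , x₂ , p , c₂ , x₁ , e , x , b , h)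

      shrinks : ∀ {s} → s ∈ Q → ¬ (s ∈ image) → length Q′ < length Q
      shrinks s∈ s∉ = filter-notAll (λ s → em {s ∈ image}) Q (lose s∈ s∉)

    -- Unless every letter fixes Q pointwise, some letter c is not onto Q. The remaining letters
    -- are fewer, and the blocks between c-edges act on the smaller set of states c(Q).
    kamp : ∀ k Q → length Q ≤ k → ∀ N {𝓢} (L : Labelling 𝓢 Q N) s₁ {s₀} → s₀ ∈ Q → Reach L s₁ s₀
    kamp k Q Q≤k N L s₁ s₀∈
      with em {Σ (Fin N) λ c → Σ T λ s → s ∈ Q × ¬ (s ∈ List.map (δ L c) Q)}
    kamp k Q Q≤k N L s₁ s₀∈ | no surj = Trivial.reach L
      (λ a → fixes (δ-mon L a) (λ {s} s∈ → decidable-stable em λ s∉ → surj (a , s , s∈ , s∉))) s₁ s₀∈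
    kamp zero [] Q≤k N L s₁ () | yes _
    kamp (suc k) Q Q≤k (suc N) L s₁ s₀∈ | yes (c , s , s∈ , s∉) =
      reach (kamp k Q′ (≤-pred (≤-trans (shrinks s∈ s∉) Q≤k)) _ L′) s₁ s₀∈
      where
      open Step L c (kamp (suc k) Q Q≤k N)

-- Nested words as binary trees

module Tree (em : ExcludedMiddle 0ℓ) {m : ℕ} where

  open Definability em {m}
  open Kamp em {m}

  MCall MRet : NestedWord m → ℕ → Set
  MCall w i = Σ ℕ λ j → μ w i j
  MRet w j  = Σ ℕ λ i → μ w i j

  data Dir : Set where
    left right : Dir

  -- The preorder of this tree is the order of positions.
  Child : NestedWord m → Dir → ℕ → ℕ → Set
  Child w left  i j = Pos w i × Pos w j × MCall w i × j ≡ suc i × ¬ MRet w j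
  Child w right i j = Pos w i × Pos w j × (μ w i j ⊎ (¬ MCall w i × j ≡ suc i × ¬ MRet w j))

  Edge : NestedWord m → ℕ → ℕ → Set
  Edge w i j = Σ Dir λ d → Child w d i j

  child-pos : ∀ w d {i j} → Child w d i j → Pos w i × Pos w j
  child-pos w left  (p , q , _) = p , q
  child-pos w right (p , q , _) = p , q

  child-cases : ∀ w d {i j} → Child w d i j → μ w i j ⊎ (j ≡ suc i × ¬ MRet w j)
  child-cases w left  (_ , _ , _ , e , r)              = inj₂ (e , r)
  child-cases w right (_ , _ , inj₁ q)                 = inj₁ q
  child-cases w right (_ , _ , inj₂ (_ , e , r))       = inj₂ (e , r)

  child-parent-unique : ∀ w {d d′ i i′ j} → Child w d i j → Child w d′ i′ j → i ≡ i′
  child-parent-unique w {d} {d′} c c′ with child-cases w d c | child-cases w d′ c′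
  ... | inj₁ q          | inj₁ q′          = μ-inj w q q′
  ... | inj₁ q          | inj₂ (_ , ¬r)    = ⊥-elim (¬r (_ , q))
  ... | inj₂ (_ , ¬r)   | inj₁ q           = ⊥-elim (¬r (_ , q))
  ... | inj₂ (refl , _) | inj₂ (refl , _)  = refl

  child-dir-unique : ∀ w {d d′ i j} → Child w d i j → Child w d′ i j → d ≡ d′
  child-dir-unique w {left}  {left}  _ _ = refl
  child-dir-unique w {right} {right} _ _ = refl
  child-dir-unique w {left}  {right} (_ , _ , c , _ , r) (_ , _ , inj₁ q) = ⊥-elim (r (_ , q))
  child-dir-unique w {left}  {right} (_ , _ , c , _ , r) (_ , _ , inj₂ (¬c , _)) = ⊥-elim (¬c c)
  child-dir-unique w {right} {left}  (_ , _ , inj₁ q) (_ , _ , c , _ , r) = ⊥-elim (r (_ , q))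
  child-dir-unique w {right} {left}  (_ , _ , inj₂ (¬c , _)) (_ , _ , c , _ , r) = ⊥-elim (¬c c)

  child-unique : ∀ w d {i j j′} → Child w d i j → Child w d i j′ → j ≡ j′
  child-unique w left  (_ , _ , _ , refl , _) (_ , _ , _ , refl , _) = refl
  child-unique w right (_ , _ , inj₁ q) (_ , _ , inj₁ q′) = μ-fun w q q′
  child-unique w right (_ , _ , inj₁ q) (_ , _ , inj₂ (¬c , _)) = ⊥-elim (¬c (_ , q))
  child-unique w right (_ , _ , inj₂ (¬c , _)) (_ , _ , inj₁ q) = ⊥-elim (¬c (_ , q))
  child-unique w right (_ , _ , inj₂ (_ , refl , _)) (_ , _ , inj₂ (_ , refl , _)) = refl

  edge-< : ∀ w {i j} → Edge w i j → i < j
  edge-< w (d , c) with child-cases w d c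
  ... | inj₁ q          = μ-< w q
  ... | inj₂ (refl , _) = ≤-refl

  path-≤ : ∀ w {α : ℕ → Set} {i j} → Path (Edge w) α i j → i ≤ j
  path-≤ w []           = ≤-refl
  path-≤ w (snoc p e _) = ≤-trans (path-≤ w p) (<⇒≤ (edge-< w e))

  -- Leaving the arc would mean stepping onto `t`. As a matched return, `t` can be entered only from
  -- its own call, which lies outside.
  path-inside : ∀ w {α : ℕ → Set} {i t x y} → μ w i t → i < x → x < t → Path (Edge w) α x y → y < t
  path-inside w q i<x x<t [] = x<t
  path-inside w q i<x x<t (snoc p (d , c) _) with path-inside w q i<x x<t p | child-cases w d c
  ... | y<t | inj₁ q′          = μ-nested w q q′ (<-≤-trans i<x (path-≤ w p)) y<t
  ... | y<t | inj₂ (refl , ¬r) = ≤∧≢⇒< y<t λ { refl → ¬r (_ , q) }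

  -- If the call of `suc i` came before `i`, the arc of `i` would be nested inside and have to end
  -- before `suc i`.
  adjacent : ∀ w {i} → MCall w i → MRet w (suc i) → μ w i (suc i)
  adjacent w {i} (t , q) (k , q′) with m≤n⇒m<n∨m≡n (≤-pred (μ-< w q′))
  ... | inj₂ refl = q′
  ... | inj₁ k<i  = ⊥-elim (<⇒≱ (μ-nested w q′ q k<i ≤-refl) (μ-< w q))

  -- The successor steps of a summary path that are not tree edges: they start at a leaf and leave
  -- the interior of an enclosing matched call.
  ExitSource : NestedWord m → ℕ → Set
  ExitSource w i = ¬ MCall w i × (Pos w (suc i) × MRet w (suc i))

  child-stays : ∀ w d {i j} → Child w d i j → ¬ ExitSource w i
  child-stays w d c (¬c , _ , r) with child-cases w d c
  ... | inj₁ q           = ¬c (_ , q)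
  ... | inj₂ (refl , ¬r) = ¬r r

  -- Tree paths and summary paths

  module _ (w : NestedWord m) {α : ℕ → Set} where

    -- A step from a matched call to its left child is a summary step only if the return lies beyond
    -- `y`. `path-inside` yields this from the rest of the path, which `go` therefore carries along.
    path-summary : ∀ {x y} → Path (Edge w) α x y → SummaryPath w (λ k → ¬ ExitSource w k) α y x
    path-summary {y = y} p = go p [] done
      where
      go : ∀ {x z} → Path (Edge w) α x z → Path (Edge w) (λ _ → ⊤) z y →
           SummaryPath w (λ k → ¬ ExitSource w k) α y z → SummaryPath w (λ k → ¬ ExitSource w k) α y x
      go [] _ s = s
      go (snoc {y = u} p (d , c) a) q s with child-cases w d c
      ... | inj₁ μu = go p (path-cons (d , c) tt q) (stepμ (child-stays w d c) μu (path-≤ w q) a s)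
      ... | inj₂ (refl , ¬r) = go p (path-cons (d , c) tt q)
        (step1 (child-stays w d c) inside (path-≤ w q) a s)
        where
        inside : ¬ (Σ ℕ λ t → μ w u t × t ≤ y)
        inside (t , μt , t≤y) = <⇒≱ (path-inside w μt ≤-refl
          (≤∧≢⇒< (μ-< w μt) λ { refl → ¬r (_ , μt) }) q) t≤y

    summary-path : ∀ {x y} → Pos w x → Pos w y → SummaryPath w (λ k → ¬ ExitSource w k) α y x →
                   Path (Edge w) α x y
    summary-path px py done = []
    summary-path px py (stepμ _ q _ a s) =
      path-cons (right , px , ret-pos w (μ-ret w q) , inj₁ q) a (summary-path (ret-pos w (μ-ret w q)) py s)
    summary-path {x} {y} px py (step1 ¬exit ¬t x<y a s) = path-cons edge a (summary-path px′ py s)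
      where
      px′ : Pos w (suc x)
      px′ = pos-≤ w (s≤s z≤n) x<y py
      edge : Edge w x (suc x)
      edge with em {MCall w x}
      -- Were `suc x` a matched return, it would be the return of `x`, and the summary path would
      -- have used the arc.
      ... | yes c = left , px , px′ , c , refl , λ r → ¬t (suc x , adjacent w c r , x<y)
      ... | no ¬c = right , px , px′ , inj₂ (¬c , refl , λ r → ¬exit (¬c , px′ , r))

  path-uncons : ∀ {E : ℕ → ℕ → Set} {α : ℕ → Set} {x z} → Path E α x z →
                x ≡ z ⊎ (Σ ℕ λ y → E x y × α y × Path E α y z)
  path-uncons [] = inj₁ refl
  path-uncons (snoc p e a) with path-uncons p
  ... | inj₁ refl              = inj₂ (_ , e , a , [])
  ... | inj₂ (y , e′ , a′ , q) = inj₂ (y , e′ , a′ , snoc q e a)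

  dμnext : ∀ {β} → Def β → Def (λ w i → Σ ℕ λ j → μ w i j × β w j)
  dμnext (φ ⟨ c ⟩) = (○μ φ) ⟨ (λ w i _ → mk⇔
    (λ (_ , j , q , h) → j , q , to (c w j (ret-pos w (μ-ret w q))) h)
    (λ (j , q , h) → μ-call w q , j , q , from (c w j (ret-pos w (μ-ret w q))) h)) ⟩

  dμprev : ∀ {β} → Def β → Def (λ w j → Σ ℕ λ i → μ w i j × β w i)
  dμprev (φ ⟨ c ⟩) = (⊖μ φ) ⟨ (λ w i _ → mk⇔
    (λ (_ , j , q , h) → j , q , to (c w j (call-pos w (μ-call w q))) h)
    (λ (j , q , h) → μ-ret w q , j , q , from (c w j (call-pos w (μ-call w q))) h)) ⟩

  dsucc : ∀ {β} → Def β → Def (λ w i → Pos w (suc i) × β w (suc i))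
  dsucc (φ ⟨ c ⟩) = (○ φ) ⟨ (λ w i _ → mk⇔
    (λ (p , h) → p , to (c w _ p) h) (λ (p , h) → p , from (c w _ p) h)) ⟩

  dpred : ∀ {β} → Def β → Def (λ w j → Σ ℕ λ i → j ≡ suc i × Pos w i × β w i)
  dpred {β} (φ ⟨ c ⟩) = (⊖ φ) ⟨ correct ⟩
    where
    correct : ∀ w i → Pos w i → (w , i ⊨ₙ (⊖ φ)) ⇔ (Σ ℕ λ j → i ≡ suc j × Pos w j × β w j)
    correct w (suc i) p = mk⇔
      (λ (1≤i , h) → let q = pos-≤ w 1≤i (n≤1+n i) p in i , refl , q , to (c w i q) h)
      (λ { (_ , refl , q , h) → proj₁ q , from (c w i q) h })

  dMCall : Def MCall
  dMCall = dresp (dμnext dtrue) λ _ _ _ → mk⇔ (λ (j , q , _) → j , q) (λ (j , q) → j , q , tt)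

  dMRet : Def MRet
  dMRet = dresp (dμprev dtrue) λ _ _ _ → mk⇔ (λ (j , q , _) → j , q) (λ (j , q) → j , q , tt)

  dExitSource : Def ExitSource
  dExitSource = dand (dnot dMCall) (dsucc dMRet)

  dchild : ∀ d {β} → Def β → Def (λ w i → Σ ℕ λ j → Child w d i j × β w j)
  dchild left dβ = dresp (dand dMCall (dsucc (dand (dnot dMRet) dβ))) λ w i p → mk⇔
    (λ (c , q , ¬r , h) → suc i , (p , q , c , refl , ¬r) , h)
    (λ { (_ , (_ , q , c , refl , ¬r) , h) → c , q , ¬r , h })
  dchild right dβ = dresp (dor (dμnext dβ) (dand (dnot dMCall) (dsucc (dand (dnot dMRet) dβ)))) λ w i p → mk⇔
    (λ { (inj₁ (j , q , h)) → j , (p , ret-pos w (μ-ret w q) , inj₁ q) , h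
       ; (inj₂ (¬c , q , ¬r , h)) → suc i , (p , q , inj₂ (¬c , refl , ¬r)) , h })
    (λ { (j , (_ , _ , inj₁ q) , h) → inj₁ (j , q , h)
       ; (_ , (_ , q , inj₂ (¬c , refl , ¬r)) , h) → inj₂ (¬c , q , ¬r , h) })

  dparent : ∀ d {β} → Def β → Def (λ w j → Σ ℕ λ i → Child w d i j × β w i)
  dparent left dβ = dresp (dand (dnot dMRet) (dpred (dand dMCall dβ))) λ w j p → mk⇔
    (λ (¬r , i , e , q , c , h) → i , (q , p , c , e , ¬r) , h)
    (λ (i , (q , _ , c , e , ¬r) , h) → ¬r , i , e , q , c , h)
  dparent right dβ = dresp (dor (dμprev dβ) (dand (dnot dMRet) (dpred (dand (dnot dMCall) dβ)))) λ w j p → mk⇔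
    (λ { (inj₁ (i , q , h)) → i , (call-pos w (μ-call w q) , p , inj₁ q) , h
       ; (inj₂ (¬r , i , e , q , ¬c , h)) → i , (q , p , inj₂ (¬c , e , ¬r)) , h })
    (λ { (i , (_ , _ , inj₁ q) , h) → inj₁ (i , q , h)
       ; (i , (q , _ , inj₂ (¬c , e , ¬r)) , h) → inj₂ (¬r , i , e , q , ¬c , h) })

  finite-Dir : Finite Dir
  finite-Dir .elems = left ∷ right ∷ []
  finite-Dir .complete left  = here refl
  finite-Dir .complete right = there (here refl)

  module _ (w : NestedWord m) {Pre Post Pre′ Post′ : ℕ → Set} where

    summary-resp : ∀ {i j} → i ≤ j →
      (∀ k → i ≤ k → k ≤ j → (k < j → Pre k) → (i < k → Post k) → (k < j → Pre′ k) × (i < k → Post′ k)) →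
      SummaryPath w Pre Post j i → SummaryPath w Pre′ Post′ j i
    summary-resp i≤j h s = visible-summary w em i≤j λ k v →
      let a , b = summary-visible w s k v in h k (proj₁ v) (proj₁ (proj₂ v)) a b

  dU : ∀ {α β} → Def α → Def β →
       Def (λ w i → Σ ℕ λ j → (i ≤ j) × Pos w j × β w j × SummaryPath w (α w) (λ _ → ⊤) j i)
  dU (φ ⟨ c ⟩) (ψ ⟨ d ⟩) = (φ U ψ) ⟨ (λ w i p → mk⇔
    (λ (j , i≤j , q , h , s) → j , i≤j , q , to (d w j q) h , summary-resp w i≤j
       (λ k i≤k k≤j a _ → to (c w k (pos-≤ w (≤-trans (proj₁ p) i≤k) k≤j q)) ∘ a , _) s)
    (λ (j , i≤j , q , h , s) → j , i≤j , q , from (d w j q) h , summary-resp w i≤j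
       (λ k i≤k k≤j a _ → from (c w k (pos-≤ w (≤-trans (proj₁ p) i≤k) k≤j q)) ∘ a , _) s)) ⟩

  dS : ∀ {α β} → Def α → Def β →
       Def (λ w i → Σ ℕ λ j → (j ≤ i) × Pos w j × β w j × SummaryPath w (λ _ → ⊤) (α w) i j)
  dS (φ ⟨ c ⟩) (ψ ⟨ d ⟩) = (φ S ψ) ⟨ (λ w i p → mk⇔
    (λ (j , j≤i , q , h , s) → j , j≤i , q , to (d w j q) h , summary-resp w j≤i
       (λ k j≤k k≤i _ a → _ , to (c w k (pos-≤ w (≤-trans (proj₁ q) j≤k) k≤i p)) ∘ a) s)
    (λ (j , j≤i , q , h , s) → j , j≤i , q , from (d w j q) h , summary-resp w j≤i
       (λ k j≤k k≤i _ a → _ , from (c w k (pos-≤ w (≤-trans (proj₁ q) j≤k) k≤i p)) ∘ a) s)) ⟩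

  dedgeNext : ∀ {β} → Def β → Def (λ w i → Σ ℕ λ j → Edge w i j × β w j)
  dedgeNext dβ = dresp (dex finite-Dir λ d → dchild d dβ) λ _ _ _ →
    mk⇔ (λ (d , j , c , h) → j , (d , c) , h) (λ (j , (d , c) , h) → d , j , c , h)

  dedgePrev : ∀ {β} → Def β → Def (λ w j → Σ ℕ λ i → Edge w i j × β w i)
  dedgePrev dβ = dresp (dex finite-Dir λ d → dparent d dβ) λ _ _ _ →
    mk⇔ (λ (d , j , c , h) → j , (d , c) , h) (λ (j , (d , c) , h) → d , j , c , h)

  -- Forbidding exits at the sources of the steps turns summary paths into tree paths.
  dpathUntil : ∀ {α β} → Def α → Def β → Def (λ w x → Σ ℕ λ y → Path (Edge w) (α w) x y × β w y)
  dpathUntil {α} {β} dα dβ =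
    dresp (dor dβ (dedgeNext (dand dα (dU (dand dα (dnot dExitSource)) (dand dα dβ))))) λ w x p → mk⇔
      -- `U` tests its left argument everywhere but at the end, a path tests `α` everywhere but at
      -- the start. Taking the first edge separately and repeating `α` at the end reconciles the
      -- two.
      (λ { (inj₁ h) → x , [] , h
         ; (inj₂ (x′ , e@(d , c) , a , y , x′≤y , q , (a′ , h) , s)) → y , path-cons e a
             (summary-path w (proj₂ (child-pos w d c)) q
               (summary-resp w x′≤y (λ k _ k≤y f _ → proj₂ ∘ f , λ _ → last w k≤y a′ f) s)) , h })
      (λ (y , π , h) → back w p π h)
    where
    last : ∀ w {k y} → k ≤ y → α w y → (k < y → α w k × ¬ ExitSource w k) → α w k
    last w k≤y a f with m≤n⇒m<n∨m≡n k≤y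
    ... | inj₁ k<y  = proj₁ (f k<y)
    ... | inj₂ refl = a
    first : ∀ w {k x} → x ≤ k → α w x → (x < k → α w k) → α w k
    first w x≤k a f with m≤n⇒m<n∨m≡n x≤k
    ... | inj₁ x<k  = f x<k
    ... | inj₂ refl = a
    end : ∀ w {x y} → α w x → Path (Edge w) (α w) x y → α w y
    end w a []           = a
    end w _ (snoc _ _ a) = a
    back : ∀ w {x y} → Pos w x → Path (Edge w) (α w) x y → β w y →
      β w x ⊎ (Σ ℕ λ x′ → Edge w x x′ × α w x′ × Σ ℕ λ y → (x′ ≤ y) × Pos w y × (α w y × β w y) ×
        SummaryPath w (λ k → α w k × ¬ ExitSource w k) (λ _ → ⊤) y x′)
    back w p π h with path-uncons π
    ... | inj₁ refl = inj₁ h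
    ... | inj₂ (x′ , e@(d , c) , a , π′) = inj₂ (x′ , e , a , _ , path-≤ w π′ ,
      (≤-trans (proj₁ (proj₂ (child-pos w d c))) (path-≤ w π′) , proj₂ (target π′)) , (end w a π′ , h) ,
      summary-resp w (path-≤ w π′)
        (λ k x′≤k _ f g → (λ k<y → first w x′≤k a g , f k<y) , _) (path-summary w π′))
      where
      target : ∀ {y} → Path (Edge w) (α w) x′ y → Pos w y
      target []                   = proj₂ (child-pos w d c)
      target (snoc _ (d , c) _) = proj₂ (child-pos w d c)

  -- Exits must be excluded at all nodes but the last, whereas `S` tests its left argument at all
  -- but the earliest. With the last edge removed every remaining node is a source, and the earliest
  -- is tested in the right argument.
  dpathSince : ∀ {α β} → Def α → Def β → Def (λ w y → Σ ℕ λ x → Path (Edge w) (α w) x y × β w x)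
  dpathSince {α} {β} dα dβ =
    dresp (dor dβ (dand dα (dedgePrev (dS (dand dα (dnot dExitSource)) (dand (dnot dExitSource) dβ)))))
      λ w y p → mk⇔
      (λ { (inj₁ h) → y , [] , h
         ; (inj₂ (a , z , e@(d , c) , x , x≤z , q , (¬l , h) , s)) → x , snoc
             (summary-path w q (proj₁ (child-pos w d c))
               (summary-resp w x≤z (λ k x≤k _ _ f → (λ _ → first w x≤k ¬l (proj₂ ∘ f)) , proj₁ ∘ f) s)) e a , h })
      (λ (x , π , h) → back w p π h)
    where
    first : ∀ w {k x} → x ≤ k → ¬ ExitSource w x → (x < k → ¬ ExitSource w k) → ¬ ExitSource w k
    first w x≤k a f with m≤n⇒m<n∨m≡n x≤k
    ... | inj₁ x<k  = f x<k
    ... | inj₂ refl = a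
    last : ∀ w {k y} → k ≤ y → ¬ ExitSource w y → (k < y → ¬ ExitSource w k) → ¬ ExitSource w k
    last w k≤y a f with m≤n⇒m<n∨m≡n k≤y
    ... | inj₁ k<y  = f k<y
    ... | inj₂ refl = a
    source-pos : ∀ w {x z} → Pos w z → Path (Edge w) (α w) x z → Pos w x
    source-pos w p []                 = p
    source-pos w p (snoc π (d , c) _) = source-pos w (proj₁ (child-pos w d c)) π
    start : ∀ w {x z} → ¬ ExitSource w z → Path (Edge w) (α w) x z → ¬ ExitSource w x
    start w ¬l []                 = ¬l
    start w ¬l (snoc π (d , c) _) = start w (child-stays w d c) π
    back : ∀ w {x y} → Pos w y → Path (Edge w) (α w) x y → β w x →
      β w y ⊎ (α w y × Σ ℕ λ z → Edge w z y × Σ ℕ λ x → (x ≤ z) × Pos w x × (¬ ExitSource w x × β w x) ×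
        SummaryPath w (λ _ → ⊤) (λ k → α w k × ¬ ExitSource w k) z x)
    back w p [] h = inj₁ h
    back w p (snoc {y = z} π e@(d , c) a) h = inj₂ (a , z , e , _ , path-≤ w π ,
      source-pos w (proj₁ (child-pos w d c)) π , (start w ¬l π , h) ,
      summary-resp w (path-≤ w π) (λ k _ k≤z f g → _ , λ x<k → g x<k , last w k≤z ¬l f) (path-summary w π))
      where
      ¬l : ¬ ExitSource w z
      ¬l = child-stays w d c

  tree : EdgeSystem
  tree = record
    { E             = Edge
    ; source-pos    = λ w (d , c) → proj₁ (child-pos w d c)
    ; target-pos    = λ w (d , c) → proj₂ (child-pos w d c)
    ; parent-unique = λ w (_ , c) (_ , c′) → child-parent-unique w c c′
    ; dnext         = dedgeNext
    ; dprev         = dedgePrev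
    ; duntil        = dpathUntil
    ; dsince        = dpathSince
    }

-- Tree algebras

module Algebras (em : ExcludedMiddle 0ℓ) {m : ℕ} where

  open Definability em {m}
  open Kamp em {m}
  open Tree em {m}

  ⌊_⌋ : Set → Bool
  ⌊ X ⌋ = does (em {X})

  ⌊⌋-cong : ∀ {X Y} → X ⇔ Y → ⌊ X ⌋ ≡ ⌊ Y ⌋
  ⌊⌋-cong h = does-⇔ h em em

  ⌊⌋-to : ∀ {X} → ⌊ X ⌋ ≡ true → X
  ⌊⌋-to {X} e with em {X}
  ⌊⌋-to e  | yes x = x
  ⌊⌋-to () | no _

  ⌊⌋-from : ∀ {X} → X → ⌊ X ⌋ ≡ true
  ⌊⌋-from = dec-true em

  In : NestedWord m → ℕ → ℕ → Set
  In w i x = Pos w i × Path (Edge w) (λ _ → ⊤) i x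

  -- An absent child is 0. Since 0 is no position, `In w 0` is empty and missing subtrees need no
  -- separate treatment.
  child : NestedWord m → Dir → ℕ → ℕ
  child w d i with em {Σ ℕ λ j → Child w d i j}
  ... | yes (j , _) = j
  ... | no _        = 0

  child-≡ : ∀ w {d i j} → Child w d i j → child w d i ≡ j
  child-≡ w {d} {i} c with em {Σ ℕ λ j → Child w d i j}
  ... | yes (j , c′) = child-unique w d c′ c
  ... | no ¬c        = ⊥-elim (¬c (_ , c))

  child-zero : ∀ w {d i} → ¬ (Σ ℕ λ j → Child w d i j) → child w d i ≡ 0
  child-zero w {d} {i} ¬c with em {Σ ℕ λ j → Child w d i j}
  ... | yes c = ⊥-elim (¬c c)
  ... | no _  = refl

  ¬in-zero : ∀ w {x} → ¬ In w 0 x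
  ¬in-zero w ((() , _) , _)

  ¬in-0 : ∀ w {i} → ¬ In w i 0
  ¬in-0 w (p , π) with path-≤ w π
  ... | z≤n with p
  ...   | () , _

  in-child : ∀ w {d i x} → In w (child w d i) x → Σ ℕ λ j → Child w d i j × In w j x
  in-child w {d} {i} h with em {Σ ℕ λ j → Child w d i j}
  ... | yes (j , c) = j , c , h
  ... | no _        = ⊥-elim (¬in-zero w h)

  in-up : ∀ w {d i x} → In w (child w d i) x → In w i x
  in-up w {d} h with in-child w h
  ... | j , c , _ , π = proj₁ (child-pos w d c) , path-cons (d , c) tt π

  in-root : ∀ w {i} → Pos w i → In w i i
  in-root w p = p , []

  in-cases : ∀ w {i x} → In w i x → x ≡ i ⊎ (Σ Dir λ d → In w (child w d i) x)
  in-cases w {x = x} (p , π) with path-uncons π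
  ... | inj₁ refl = inj₁ refl
  ... | inj₂ (j , (d , c) , _ , π′) =
    inj₂ (d , subst (λ j → In w j x) (sym (child-≡ w c)) (proj₂ (child-pos w d c) , π′))

  in-child-< : ∀ w {d i x} → In w (child w d i) x → i < x
  in-child-< w {d} h with in-child w h
  ... | j , c , _ , π = <-≤-trans (edge-< w (d , c)) (path-≤ w π)

  in-left-right : ∀ w {i x y} → In w (child w left i) x → In w (child w right i) y → x < y
  in-left-right w {i} h h′ with in-child w h | in-child w h′
  ... | j , (_ , _ , mc , _) , _ | k , (_ , _ , inj₂ (¬mc , _)) , _ = ⊥-elim (¬mc mc)
  ... | j , (_ , _ , _ , refl , ¬r) , _ , π | k , (_ , _ , inj₁ q) , _ , π′ =
    <-≤-trans (path-inside w q ≤-refl (≤∧≢⇒< (μ-< w q) λ { refl → ¬r (_ , q) }) π) (path-≤ w π′)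

  in-disjoint : ∀ w {i x} → In w (child w left i) x → ¬ In w (child w right i) x
  in-disjoint w h h′ = <-irrefl refl (in-left-right w h h′)

  -- Every position after 1 has a parent: its call if it is a matched return, its predecessor
  -- otherwise. So the value at 1 is that of the whole word.
  in-first : ∀ w i → Pos w i → In w 1 i
  in-first w i p = pos-≤ w ≤-refl (proj₁ p) p , go i i ≤-refl p
    where
    go : ∀ k i → i ≤ k → Pos w i → Path (Edge w) (λ _ → ⊤) 1 i
    go zero    zero    _   (() , _)
    go (suc k) (suc zero) _ p = []
    go (suc k) (suc (suc i)) i≤k p with em {MRet w (suc (suc i))}
    ... | yes (c , q) = snoc (go k c (≤-pred (≤-trans (μ-< w q) i≤k)) pc) (right , pc , p , inj₁ q) tt
      where pc = call-pos w (μ-call w q)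
    ... | no ¬r with em {MCall w (suc i)}
    ...   | yes mc = snoc (go k (suc i) (≤-pred i≤k) q) (left , q , p , mc , refl , ¬r) tt
      where q = pos-≤ w (s≤s z≤n) (n≤1+n (suc i)) p
    ...   | no ¬mc = snoc (go k (suc i) (≤-pred i≤k) q) (right , q , p , inj₂ (¬mc , refl , ¬r)) tt
      where q = pos-≤ w (s≤s z≤n) (n≤1+n (suc i)) p

  -- Being a matched call is recorded apart from `call`, which pending calls satisfy too.
  Kind : Set
  Kind = Fin m × Bool × Bool × Bool

  finite-Kind : Finite Kind
  finite-Kind = finite-× (finite-Fin m) (finite-× finite-Bool (finite-× finite-Bool finite-Bool))

  kind : NestedWord m → ℕ → Kind
  kind w i = lab w i , ⌊ call w i ⌋ , ⌊ ret w i ⌋ , ⌊ MCall w i ⌋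

  dflag : ∀ {A} → Def A → ∀ b → Def (λ w i → ⌊ A w i ⌋ ≡ b)
  dflag dA true  = dresp dA (λ _ _ _ → mk⇔ ⌊⌋-from ⌊⌋-to)
  dflag dA false = dresp (dnot dA) (λ _ _ _ → mk⇔ (dec-false em) (λ e a → true≢false (trans (sym (⌊⌋-from a)) e)))
    where
    true≢false : true ≢ false
    true≢false ()

  dkind : ∀ k → Def (λ w i → kind w i ≡ k)
  dkind (a , c , r , mc) = dresp
    (dand (lbl a ⟨ (λ _ _ _ → mk⇔ id id) ⟩) (dand (dflag (callₙ ⟨ (λ _ _ _ → mk⇔ id id) ⟩) c)
      (dand (dflag (retₙ ⟨ (λ _ _ _ → mk⇔ id id) ⟩) r) (dflag dMCall mc))))
    (λ _ _ _ → mk⇔ (λ { (refl , refl , refl , refl) → refl }) (λ { refl → refl , refl , refl , refl }))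

  Marks : ℕ → Set
  Marks n = Vec Bool n

  marks : (Fin n → ℕ) → ℕ → Marks n
  marks ρ i = tabulate λ x → does (ρ x ≟ i)

  none : Marks n
  none = replicate _ false

  marks-none : ∀ n (ρ : Fin n → ℕ) i → (∀ x → ρ x ≢ i) → marks ρ i ≡ none
  marks-none zero    ρ i h = refl
  marks-none (suc n) ρ i h = cong₂ _∷_ (dec-false (ρ zero ≟ i) (h zero)) (marks-none n (ρ ∘ suc) i (h ∘ suc))

  -- Position 0 belongs to no word, so it stands for an absent mark.
  unmarked : Fin n → ℕ
  unmarked _ = 0

  -- Only the nodes on the branch are unmarked; the sibling values `t` range over all of `T`,
  -- realised or not, which makes aperiodicity a property of `node` alone. The identity is added in
  -- `Marked.Mon`.
  data Context {T : Set} (node : Kind → Marks n → T → T → T) : (T → T) → Set where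
    ctx-∘     : ∀ {g h} → Context node g → Context node h → Context node (g ∘ h)
    ctx-left  : ∀ k t → Context node (λ s → node k none s t)
    ctx-right : ∀ k t → Context node (λ s → node k none t s)

  Agree : NestedWord m → ℕ → (Fin n → ℕ) → (Fin n → ℕ) → Set
  Agree w i ρ σ = ∀ x → ρ x ≡ σ x ⊎ (¬ In w i (ρ x) × ¬ In w i (σ x))

  -- `val-local` lets the subtrees off the branch to a mark be evaluated as unmarked, where `dval`
  -- applies.
  record Algebra (n : ℕ) : Set₁ where
    field
      T         : Set
      finite    : Finite T
      node      : Kind → Marks n → T → T → T
      aperiodic : ∀ {g} → Context node g → Σ ℕ λ k → ∀ s → iter k g s ≡ iter (suc k) g s
      val       : NestedWord m → (Fin n → ℕ) → ℕ → T
      empty     : T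
      val-zero  : ∀ w ρ → val w ρ 0 ≡ empty
      val-node  : ∀ w ρ i → Pos w i →
                  val w ρ i ≡ node (kind w i) (marks ρ i) (val w ρ (child w left i)) (val w ρ (child w right i))
      val-local : ∀ w ρ σ i → Agree w i ρ σ → val w ρ i ≡ val w σ i
      dval      : ∀ t → Def (λ w i → val w unmarked i ≡ t)

    dchildval : ∀ d t → Def (λ w i → val w unmarked (child w d i) ≡ t)
    dchildval d t = dresp
      (dor (dchild d (dval t)) (dand (dnot (dchild d dtrue)) (dconst (empty ≡ t)))) λ w i _ → mk⇔
      (λ { (inj₁ (j , c , e)) → trans (cong (val w unmarked) (child-≡ w c)) e
         ; (inj₂ (¬c , e)) → trans (cong (val w unmarked) (child-zero w λ (j , c) → ¬c (j , c , tt)))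
                                   (trans (val-zero w unmarked) e) })
      (back w i)
      where
      back : ∀ w i → val w unmarked (child w d i) ≡ t →
        (Σ ℕ λ j → Child w d i j × val w unmarked j ≡ t) ⊎
        (¬ (Σ ℕ λ j → Child w d i j × ⊤) × empty ≡ t)
      back w i e with em {Σ ℕ λ j → Child w d i j}
      ... | yes (j , c) = inj₁ (j , c , e)
      ... | no ¬c = inj₂ ((λ (j , c , _) → ¬c (j , c)) , trans (sym (val-zero w unmarked)) e)

  -- One mark: values along the branch leading to it

  module Marked {n} (𝓐 : Algebra (suc n)) where

    open Algebra 𝓐

    mark : ℕ → Fin (suc n) → ℕ
    mark y = extend y unmarked

    Mon : (T → T) → Set
    Mon g = (∀ s → g s ≡ s) ⊎ (Σ (T → T) λ h → Context node h × (∀ s → h s ≡ g s))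

    iter-≗ : ∀ {X : Set} {g h : X → X} → (∀ s → h s ≡ g s) → ∀ k s → iter k h s ≡ iter k g s
    iter-≗ e zero    s = refl
    iter-≗ {g = g} {h} e (suc k) s = trans (e (iter k h s)) (cong g (iter-≗ e k s))

    mon-∘ : ∀ {g h} → Mon g → Mon h → Mon (g ∘ h)
    mon-∘ (inj₁ e) (inj₁ e′) = inj₁ λ s → trans (e _) (e′ s)
    mon-∘ (inj₁ e) (inj₂ (h′ , c , e′)) = inj₂ (h′ , c , λ s → trans (e′ s) (sym (e _)))
    mon-∘ {g} (inj₂ (g′ , c , e)) (inj₁ e′) = inj₂ (g′ , c , λ s → trans (e s) (cong g (sym (e′ s))))
    mon-∘ (inj₂ (g′ , c , e)) (inj₂ (h′ , c′ , e′)) =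
      inj₂ (g′ ∘ h′ , ctx-∘ c c′ , λ s → trans (cong g′ (e′ s)) (e _))

    mon-≗ : ∀ {g h} → (∀ s → g s ≡ h s) → Mon g → Mon h
    mon-≗ e (inj₁ e′)            = inj₁ λ s → trans (sym (e s)) (e′ s)
    mon-≗ e (inj₂ (g′ , c , e′)) = inj₂ (g′ , c , λ s → trans (e′ s) (e s))

    mon-aperiodic : ∀ {g} → Mon g → Σ ℕ λ k → ∀ s → iter k g s ≡ iter (suc k) g s
    mon-aperiodic (inj₁ e)           = 0 , λ s → sym (e s)
    mon-aperiodic (inj₂ (h , c , e)) = let k , p = aperiodic c in
      k , λ s → trans (sym (iter-≗ e k s)) (trans (p s) (iter-≗ e (suc k) s))

    open Transformations finite Mon (inj₁ λ _ → refl) mon-∘ mon-≗ mon-aperiodic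

    Letter : Set
    Letter = Kind × Dir × T

    finite-Letter : Finite Letter
    finite-Letter = finite-× finite-Kind (finite-× finite-Dir finite)

    act : Letter → T → T
    act (k , left  , t) s = node k none s t
    act (k , right , t) s = node k none t s

    opposite : Dir → Dir
    opposite left  = right
    opposite right = left

    -- The sibling subtree is evaluated without marks because the only mark lies below `y`; its
    -- value is then definable, and so is the letter.
    Labels : Letter → Pred
    Labels (k , d , t) w y = Σ ℕ λ x → Child w d x y × kind w x ≡ k × val w unmarked (child w (opposite d) x) ≡ t

    act-mon : ∀ l → Mon (act l)
    act-mon (k , left  , t) = inj₂ (_ , ctx-left k t , λ _ → refl)
    act-mon (k , right , t) = inj₂ (_ , ctx-right k t , λ _ → refl)

    labels-total : ∀ w {x y} → Edge w x y → Σ Letter λ l → Labels l w y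
    labels-total w (d , c) = (_ , d , _) , _ , c , refl , refl

    labels-unique : ∀ w {y l l′} → Labels l w y → Labels l′ w y → l ≡ l′
    labels-unique w {l = _ , d , _} {_ , d′ , _} (x , c , refl , refl) (x′ , c′ , refl , refl)
      with refl ← child-parent-unique w {d} {d′} c c′
      with refl ← child-dir-unique w {d} {d′} c c′ = refl

    letter : Fin (length (elems finite-Letter)) → Letter
    letter = List.lookup (elems finite-Letter)

    labelling : Labelling tree (elems finite) (length (elems finite-Letter))
    labelling = record
      { δ     = act ∘ letter
      ; Λ     = Labels ∘ letter
      ; dΛ    = λ a → let k , d , t = letter a in dparent d (dand (dkind k) (dchildval (opposite d) t))
      ; δ-mon = act-mon ∘ letter
      ; δ-closed   = λ a _ → complete finite _
      ; total = λ w {x} {y} e → let l , h = labels-total w e in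
          index (complete finite-Letter l) ,
          subst (λ l → Labels l w y) (lookup-index (complete finite-Letter l)) h
      ; agree = λ w _ l l′ {s} _ → cong (λ a → act a s) (labels-unique w l l′)
      }

    open Labelling labelling using (RunL; total)

    val-step : ∀ w {x y z l} → Edge w x y → Labels l w y → In w y z →
               val w (mark z) x ≡ act l (val w (mark z) y)
    val-step w {x} {y} {z} {k , d , t} e (x′ , c , refl , refl) iz
      with refl ← child-parent-unique w (proj₂ e) c =
      trans (val-node w (mark z) x (proj₁ (child-pos w d c)))
        (trans (cong (λ M → node (kind w x) M (val w (mark z) (child w left x)) (val w (mark z) (child w right x))) (marks-none _ (mark z) x λ
           { zero refl → <-irrefl refl (in-child-< w iz′)
           ; (suc _) refl → n≮0 (proj₁ (proj₁ (child-pos w d c))) }))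
          (sides d c iz′))
      where
      iz′ : In w (child w d x) z
      iz′ = subst (λ y → In w y z) (sym (child-≡ w c)) iz
      away : ∀ d → ¬ In w (child w d x) z → val w (mark z) (child w d x) ≡ val w unmarked (child w d x)
      away d ¬i = val-local w (mark z) unmarked _ λ
        { zero → inj₂ (¬i , ¬in-0 w) ; (suc _) → inj₁ refl }
      sides : ∀ d → Child w d x y → In w (child w d x) z →
        node (kind w x) none (val w (mark z) (child w left x)) (val w (mark z) (child w right x)) ≡
        act (kind w x , d , val w unmarked (child w (opposite d) x)) (val w (mark z) y)
      sides left  c i = cong₂ (node (kind w x) none) (cong (val w (mark z)) (child-≡ w c)) (away right (in-disjoint w i))
      sides right c i = cong₂ (node (kind w x) none) (away left (λ j → in-disjoint w j i)) (cong (val w (mark z)) (child-≡ w c))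

    -- Together with `val-run` this turns values into runs: a run whose lower state is the value at
    -- `y` has the value at `x` as its upper state.
    run-val : ∀ w {x s y r z} → RunL w x s y r → In w y z → r ≡ val w (mark z) y → s ≡ val w (mark z) x
    run-val w [] i e = e
    run-val w (snoc a p e l) i refl =
      run-val w p (proj₁ (child-pos w _ (proj₂ e)) , path-cons e tt (proj₂ i)) (sym (val-step w e l i))

    val-run : ∀ w {x y z} → Path (Edge w) (λ _ → ⊤) x y → In w y z →
              RunL w x (val w (mark z) x) y (val w (mark z) y)
    val-run w [] i = []
    val-run w {x} {z = z} (snoc {y = u} p e _) i with total w e
    ... | a , l = snoc a (subst (RunL w x (val w (mark z) x) u) (val-step w e l i)
                    (val-run w p (proj₁ (child-pos w _ (proj₂ e)) , path-cons e tt (proj₂ i)))) e l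

    -- The starting state of the runs. Both subtrees below the mark are unmarked, so their values
    -- are definable.
    dvalAtMark : ∀ t → Def (λ w y → val w (mark y) y ≡ t)
    dvalAtMark t = dresp
      (dex (finite-× finite-Kind (finite-× finite finite)) λ (k , t₁ , t₂) →
        dand (dand (dkind k) (dand (dchildval left t₁) (dchildval right t₂)))
             (dconst (node k (true ∷ none) t₁ t₂ ≡ t)))
      λ w y p → mk⇔
        (λ { (_ , (refl , refl , refl) , e) → trans (eq w y p) e })
        (λ e → _ , (refl , refl , refl) , trans (sym (eq w y p)) e)
      where
      eq : ∀ w y → Pos w y → val w (mark y) y ≡
           node (kind w y) (true ∷ none) (val w unmarked (child w left y)) (val w unmarked (child w right y))
      eq w y p = trans (val-node w (mark y) y p)
        (cong₃ (λ M t₁ t₂ → node (kind w y) M t₁ t₂)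
          (cong₂ _∷_ (dec-true (y ≟ y) refl) (marks-none _ unmarked y λ { _ refl → n≮0 (proj₁ p) }))
          (away left) (away right))
        where
        cong₃ : ∀ {A B C D : Set} (f : A → B → C → D) {a a′ b b′ c c′} →
                a ≡ a′ → b ≡ b′ → c ≡ c′ → f a b c ≡ f a′ b′ c′
        cong₃ f refl refl refl = refl
        away : ∀ d → val w (mark y) (child w d y) ≡ val w unmarked (child w d y)
        away d = val-local w (mark y) unmarked _ λ
          { zero → inj₂ ((λ i → <-irrefl refl (in-child-< w i)) , ¬in-0 w) ; (suc _) → inj₁ refl }

    reach : ∀ s₁ s₀ → Reach labelling s₁ s₀
    reach s₁ s₀ = kamp _ (elems finite) ≤-refl _ labelling s₁ (complete finite s₀)

    -- Read from the top by until; this supplies the definability of unmarked values after a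
    -- quantifier.
    dvalSome : ∀ t → Def (λ w x → Σ ℕ λ y → In w x y × t ≡ val w (mark y) x)
    dvalSome t = dresp (dex finite λ s₀ → proj₁ (reach t s₀ (dvalAtMark s₀))) λ w x p → mk⇔
      (λ (s₀ , y , r , e) → let π = path-map id _ (Labelling.run-path labelling w r) in
        y , (p , π) , run-val w r (EdgeSystem.path-target-pos tree w p π , []) (sym e))
      (λ { (y , (_ , π) , refl) → _ , y ,
           val-run w π (EdgeSystem.path-target-pos tree w p π , []) , refl })

    -- Read from the mark by since; this yields the temporal formula for a first-order formula with
    -- one free variable.
    dvalRoot : ∀ t → Def (λ w y → val w (mark y) 1 ≡ t)
    dvalRoot t = dresp
      (dex finite λ s₀ → dand (dvalAtMark s₀) (proj₂ (reach t s₀ dfirst))) λ w y p → mk⇔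
      (λ { (s₀ , e , x , r , refl) → sym (run-val w r (p , []) (sym e)) })
      (λ { refl → _ , refl , 1 , val-run w (proj₂ (in-first w y p)) (p , []) , refl })
      where
      dfirst : Def (λ _ i → i ≡ 1)
      dfirst = dresp (dnot (dpred dtrue)) λ
        { w zero (() , _) ; w (suc zero) p → mk⇔ (λ _ → refl) (λ { _ (_ , refl , (() , _) , _) })
        ; w (suc (suc i)) p → mk⇔ (λ k → ⊥-elim (k (suc i , refl , pos-≤ w (s≤s z≤n) (n≤1+n (suc i)) p , tt))) λ () }

-- Atomic formulas

module Recognition (em : ExcludedMiddle 0ℓ) {m : ℕ} where

  open Definability em {m}
  open Kamp em {m}
  open Tree em {m}
  open Algebras em {m}
  open Algebra

  iter-stable : {X : Set} {g : X → X} → ∀ {k} → (∀ s → iter k g s ≡ iter (suc k) g s) →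
                ∀ {j} → k ≤ j → ∀ s → iter j g s ≡ iter (suc j) g s
  iter-stable {g = g} {zero}  e {zero}  _ s = e s
  iter-stable {g = g} {suc k} e {zero}  () s
  iter-stable {g = g} {k} e {suc j} k≤j s with m≤n⇒m<n∨m≡n k≤j
  ... | inj₁ k<j  = cong g (iter-stable e (≤-pred k<j) s)
  ... | inj₂ refl = e s

  Grows : {X : Set} → (X → ℕ) → X → X → Set
  Grows h x y = y ≡ x ⊎ h x < h y

  -- Each application that changes something raises the height, so `suc k` applications have either
  -- stabilised or reached height `suc k`; past the bound only the first is possible. The atomic
  -- algebras use the number of settled flags as height.
  grows-aperiodic : {X : Set} (h : X → ℕ) (b : ℕ) → (∀ x → h x ≤ b) →
    {g : X → X} → (∀ x → Grows h x (g x)) → ∀ x → iter b g x ≡ iter (suc b) g x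
  grows-aperiodic {X} h b bound {g} grows x with chain b
    where
    chain : ∀ k → iter (suc k) g x ≡ iter k g x ⊎ suc k ≤ h (iter (suc k) g x)
    chain zero with grows x
    ... | inj₁ e = inj₁ e
    ... | inj₂ l = inj₂ (≤-trans (s≤s z≤n) l)
    chain (suc k) with chain k | grows (iter (suc k) g x)
    ... | inj₁ e | _      = inj₁ (cong g e)
    ... | inj₂ _ | inj₁ e = inj₁ e
    ... | inj₂ l | inj₂ l′ = inj₂ (≤-<-trans l l′)
  ... | inj₁ e = sym e
  ... | inj₂ l = ⊥-elim (<⇒≱ l (bound _))

  module _ {n : ℕ} {X : Set} {node : Kind → Marks n → X → X → X} (h : X → ℕ)
    (growsˡ : ∀ k x y → Grows h x (node k none x y)) (growsʳ : ∀ k x y → Grows h y (node k none x y)) where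

    context-grows : ∀ {g} → Context node g → ∀ x → Grows h x (g x)
    context-grows (ctx-left k t)  x = growsˡ k x t
    context-grows (ctx-right k t) x = growsʳ k t x
    context-grows (ctx-∘ {g} {f} c d) x with context-grows d x | context-grows c (f x)
    ... | inj₁ e | inj₁ e′ = inj₁ (trans e′ e)
    ... | inj₁ e | inj₂ l  = inj₂ (subst (λ y → h y < h (g (f x))) e l)
    ... | inj₂ l | inj₁ e  = inj₂ (subst (λ y → h x < h y) (sym e) l)
    ... | inj₂ l | inj₂ l′ = inj₂ (<-trans l l′)

  weight : Bool → ℕ
  weight false = 0
  weight true  = 1

  weight≤1 : ∀ b → weight b ≤ 1
  weight≤1 false = z≤n
  weight≤1 true  = s≤s z≤n

  grows-refl : ∀ {b} → Grows weight b b
  grows-refl = inj₁ refl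

  grows-∨ʳ : ∀ {b c} a → Grows weight b c → Grows weight b (a ∨ c)
  grows-∨ʳ {false} true  _ = inj₂ (s≤s z≤n)
  grows-∨ʳ {true}  true  _ = inj₁ refl
  grows-∨ʳ         false g = g

  grows-∨ˡ : ∀ {b c} a → Grows weight b c → Grows weight b (c ∨ a)
  grows-∨ˡ {c = true} a g = g
  grows-∨ˡ {false} {false} false g = g
  grows-∨ˡ {false} {false} true  g = inj₂ (s≤s z≤n)
  grows-∨ˡ {true}  {false} a (inj₁ ())
  grows-∨ˡ {true}  {false} a (inj₂ ())

  grows-× : {X Y : Set} (h : X → ℕ) (h′ : Y → ℕ) → ∀ {x x′ y y′} → Grows h x x′ → Grows h′ y y′ →
            Grows (λ (x , y) → h x + h′ y) (x , y) (x′ , y′)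
  grows-× h h′ (inj₁ refl) (inj₁ refl) = inj₁ refl
  grows-× h h′ {x = x} (inj₁ refl) (inj₂ l) = inj₂ (+-monoʳ-< (h x) l)
  grows-× h h′ {y = y} (inj₂ l) (inj₁ refl) = inj₂ (+-monoˡ-< (h′ y) l)
  grows-× h h′ (inj₂ l) (inj₂ l′) = inj₂ (+-mono-< l l′)

  ⌊⌋-≡ : ∀ {X b} → (X → b ≡ true) → (b ≡ true → X) → ⌊ X ⌋ ≡ b
  ⌊⌋-≡ {X} {b} f g with em {X}
  ... | yes x = sym (f x)
  ⌊⌋-≡ {X} {false} f g | no ¬x = refl
  ⌊⌋-≡ {X} {true}  f g | no ¬x = ⊥-elim (¬x (g refl))

  ⌊⌋-no : ∀ {X} → ¬ X → ⌊ X ⌋ ≡ false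
  ⌊⌋-no = dec-false em

  ∨-to : ∀ {a b} → a ∨ b ≡ true → a ≡ true ⊎ b ≡ true
  ∨-to {true}  _ = inj₁ refl
  ∨-to {false} e = inj₂ e

  ∨-fromˡ : ∀ {a b} → a ≡ true → a ∨ b ≡ true
  ∨-fromˡ refl = refl

  ∨-fromʳ : ∀ {a b} → b ≡ true → a ∨ b ≡ true
  ∨-fromʳ {true}  refl = refl
  ∨-fromʳ {false} refl = refl

  ∧-to : ∀ {a b} → a ∧ b ≡ true → a ≡ true × b ≡ true
  ∧-to {true} e = refl , e

  ∧-from : ∀ {a b} → a ≡ true → b ≡ true → a ∧ b ≡ true
  ∧-from refl refl = refl

  marked-to : ∀ {n} (ρ : Fin n → ℕ) x {i} → lookup (marks ρ i) x ≡ true → ρ x ≡ i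
  marked-to ρ x {i} e = does⇒ (ρ x ≟ i) (trans (sym (lookup∘tabulate (λ x → does (ρ x ≟ i)) x)) e)
    where
    does⇒ : ∀ {A : Set} (d : Dec A) → does d ≡ true → A
    does⇒ (yes a) _ = a

  marked-from : ∀ {n} (ρ : Fin n → ℕ) x {i} → ρ x ≡ i → lookup (marks ρ i) x ≡ true
  marked-from ρ x {i} e = trans (lookup∘tabulate (λ x → does (ρ x ≟ i)) x) (dec-true (ρ x ≟ i) e)

  agree-in : ∀ {n} w {i} {ρ σ : Fin n → ℕ} → Agree w i ρ σ → ∀ x → In w i (ρ x) → ρ x ≡ σ x
  agree-in w ag x h with ag x
  ... | inj₁ e        = e
  ... | inj₂ (¬h , _) = ⊥-elim (¬h h)

  agree-sym : ∀ {n} w {i} {ρ σ : Fin n → ℕ} → Agree w i ρ σ → Agree w i σ ρ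
  agree-sym w ag x with ag x
  ... | inj₁ e       = inj₁ (sym e)
  ... | inj₂ (a , b) = inj₂ (b , a)

  record Recognizer {n : ℕ} (φ : FO m n) : Set₁ where
    field
      algebra : Algebra n
      accept  : T algebra → Set
      correct : ∀ w ρ → Pos w 1 → (∀ x → Pos w (ρ x)) → (w ⊨ᶠ φ [ ρ ]) ⇔ accept (val algebra w ρ 1)

  open Recognizer

  -- For the atomic formulas witnessed at a single position: labels, calls, returns and equality. By
  -- `test-none` the value without marks is constantly false.
  module Local {n : ℕ} (test : Kind → Marks n → Bool) (test-none : ∀ k → test k none ≡ false) where

    Found : NestedWord m → (Fin n → ℕ) → ℕ → Set
    Found w ρ i = Σ ℕ λ p → In w i p × test (kind w p) (marks ρ p) ≡ true

    found-local : ∀ w {ρ σ i} → Agree w i ρ σ → Found w ρ i → Found w σ i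
    found-local w {ρ} {σ} {i} ag (p , h , e) = p , h , trans (cong (test (kind w p)) (sym same)) e
      where
      same : marks ρ p ≡ marks σ p
      same = tabulate-cong λ x → does-⇔
        (mk⇔ (λ { refl → sym (agree-in w ag x h) }) (λ { refl → sym (agree-in w (agree-sym w ag) x h) }))
        (ρ x ≟ p) (σ x ≟ p)

    step : Kind → Marks n → Bool → Bool → Bool
    step k M a b = test k M ∨ (a ∨ b)

    local : Algebra n
    local .T = Bool
    local .finite = finite-Bool
    local .node = step
    local .aperiodic c = 1 , grows-aperiodic weight 1 weight≤1 (context-grows weight
      (λ k a b → grows-∨ʳ (test k none) (grows-∨ˡ b grows-refl))
      (λ k a b → grows-∨ʳ (test k none) (grows-∨ʳ a grows-refl)) c)
    local .val w ρ i = ⌊ Found w ρ i ⌋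
    local .empty = false
    local .val-zero w ρ = ⌊⌋-no λ (_ , h , _) → ¬in-zero w h
    local .val-node w ρ i p = ⌊⌋-≡ there-is is-there
      where
      there-is : Found w ρ i → step (kind w i) (marks ρ i) ⌊ Found w ρ (child w left i) ⌋ ⌊ Found w ρ (child w right i) ⌋ ≡ true
      there-is (q , h , e) with in-cases w h
      ... | inj₁ refl = ∨-fromˡ e
      ... | inj₂ (left , h′)  = ∨-fromʳ {test (kind w i) _} (∨-fromˡ (⌊⌋-from (q , h′ , e)))
      ... | inj₂ (right , h′) = ∨-fromʳ {test (kind w i) _} (∨-fromʳ {⌊ Found w ρ (child w left i) ⌋} (⌊⌋-from (q , h′ , e)))
      is-there : step (kind w i) (marks ρ i) ⌊ Found w ρ (child w left i) ⌋ ⌊ Found w ρ (child w right i) ⌋ ≡ true → Found w ρ i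
      is-there e with ∨-to {test (kind w i) _} e
      ... | inj₁ e′ = i , in-root w p , e′
      ... | inj₂ e′ with ∨-to {⌊ Found w ρ (child w left i) ⌋} e′
      ...   | inj₁ l = let q , h , e = ⌊⌋-to l in q , in-up w h , e
      ...   | inj₂ r = let q , h , e = ⌊⌋-to r in q , in-up w h , e
    local .val-local w ρ σ i ag = ⌊⌋-cong (mk⇔ (found-local w ag) (found-local w (agree-sym w ag)))
    local .dval t = dresp (dconst (false ≡ t)) λ w i _ →
      mk⇔ (trans (⌊⌋-no (absent w))) (trans (sym (⌊⌋-no (absent w))))
      where
      absent : ∀ w {i} → ¬ Found w unmarked i
      absent w {i} (p , h , e) with trans (sym (test-none (kind w p)))
        (trans (cong (test (kind w p)) (sym (marks-none n unmarked p λ { _ refl → ¬in-0 w h }))) e)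
      ... | ()

  module _ {n : ℕ} where

    recognize-local : ∀ {φ : FO m n} (test : Kind → Marks n → Bool) (test-none : ∀ k → test k none ≡ false) →
      (∀ w ρ → (∀ x → Pos w (ρ x)) → (w ⊨ᶠ φ [ ρ ]) ⇔
        (Σ ℕ λ p → Pos w p × test (kind w p) (marks ρ p) ≡ true)) → Recognizer φ
    recognize-local test test-none h = record
      { algebra = Local.local test test-none
      ; accept  = _≡ true
      ; correct = λ w ρ _ q → mk⇔
          (λ s → let p , r , e = to (h w ρ q) s in ⌊⌋-from (p , in-first w p r , e))
          (λ e → let p , (p₁ , π) , e = ⌊⌋-to e in
             from (h w ρ q) (p , EdgeSystem.path-target-pos tree w p₁ π , e))
      }

    recognize-unary : ∀ {φ : FO m n} (test : Kind → Bool) x →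
      (∀ w ρ → Pos w (ρ x) → (w ⊨ᶠ φ [ ρ ]) ⇔ (test (kind w (ρ x)) ≡ true)) → Recognizer φ
    recognize-unary test x h = recognize-local (λ k M → lookup M x ∧ test k)
      (λ k → cong (_∧ test k) (lookup-replicate x false))
      λ w ρ q → mk⇔ (λ s → ρ x , q x , ∧-from (marked-from ρ x refl) (to (h w ρ (q x)) s))
                    (λ (p , r , e) → from (h w ρ (q x)) (unary w ρ e))
      where
      unary : ∀ w ρ {p} → lookup (marks ρ p) x ∧ test (kind w p) ≡ true → test (kind w (ρ x)) ≡ true
      unary w ρ e with ∧-to e
      ... | e₁ , e₂ with refl ← marked-to ρ x e₁ = e₂

    recognize-P : ∀ a x → Recognizer (P a x)
    recognize-P a x = recognize-unary (λ (b , _) → ⌊ b ≡ a ⌋) x λ w ρ _ → mk⇔ ⌊⌋-from ⌊⌋-to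

    recognize-call : ∀ x → Recognizer (callᶠ x)
    recognize-call x = recognize-unary (λ (_ , c , _) → c) x λ w ρ _ → mk⇔ ⌊⌋-from ⌊⌋-to

    recognize-ret : ∀ x → Recognizer (retᶠ x)
    recognize-ret x = recognize-unary (λ (_ , _ , r , _) → r) x λ w ρ _ → mk⇔ ⌊⌋-from ⌊⌋-to

    recognize-≐ : ∀ x y → Recognizer (x ≐ y)
    recognize-≐ x y = recognize-local (λ _ M → lookup M x ∧ lookup M y)
      (λ k → cong (_∧ lookup none y) (lookup-replicate x false))
      λ w ρ q → mk⇔ (λ e → ρ x , q x , ∧-from (marked-from ρ x refl) (marked-from ρ y (sym e)))
                    (λ (p , _ , e) → let e₁ , e₂ = ∧-to e in trans (marked-to ρ x e₁) (sym (marked-to ρ y e₂)))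

  module Order {n : ℕ} (x y : Fin n) where

    In-cong : ∀ w {ρ σ : Fin n → ℕ} {i} → Agree w i ρ σ → ∀ z → In w i (ρ z) → In w i (σ z)
    In-cong w ag z h = subst (In w _) (agree-in w ag z h) h

    Before : NestedWord m → (Fin n → ℕ) → ℕ → Set
    Before w ρ i = In w i (ρ x) × In w i (ρ y) × ρ x < ρ y

    -- Preorder decides the third flag: a node precedes its subtrees, and the left subtree precedes
    -- the right one.
    step : Kind → Marks n → Bool × Bool × Bool → Bool × Bool × Bool → Bool × Bool × Bool
    step _ M (a , b , c) (a′ , b′ , c′) =
      lookup M x ∨ (a ∨ a′) , lookup M y ∨ (b ∨ b′) ,
      (lookup M x ∧ (b ∨ b′)) ∨ ((a ∧ b′) ∨ (c ∨ c′))

    order-weight : Bool × Bool × Bool → ℕ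
    order-weight (a , b , c) = weight a + (weight b + weight c)

    order : Algebra n
    order .T = Bool × Bool × Bool
    order .finite = finite-× finite-Bool (finite-× finite-Bool finite-Bool)
    order .node = step
    -- Three flags, each of which can only be switched on.
    order .aperiodic c = 3 , grows-aperiodic order-weight 3
      (λ (a , b , c) → +-mono-≤ (weight≤1 a) (+-mono-≤ (weight≤1 b) (weight≤1 c)))
      (context-grows order-weight
        (λ k (a , b , c) (a′ , b′ , c′) → grows-× weight (λ (b , c) → weight b + weight c) (grows-∨ʳ (lookup none x) (grows-∨ˡ a′ grows-refl))
          (grows-× weight weight (grows-∨ʳ (lookup none y) (grows-∨ˡ b′ grows-refl))
            (grows-∨ʳ (lookup none x ∧ (b ∨ b′)) (grows-∨ʳ (a ∧ b′) (grows-∨ˡ c′ grows-refl)))))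
        (λ k (a , b , c) (a′ , b′ , c′) → grows-× weight (λ (b , c) → weight b + weight c) (grows-∨ʳ (lookup none x) (grows-∨ʳ a grows-refl))
          (grows-× weight weight (grows-∨ʳ (lookup none y) (grows-∨ʳ b grows-refl))
            (grows-∨ʳ (lookup none x ∧ (b ∨ b′)) (grows-∨ʳ (a ∧ b′) (grows-∨ʳ c grows-refl)))))
        c)
    order .val w ρ i = ⌊ In w i (ρ x) ⌋ , ⌊ In w i (ρ y) ⌋ , ⌊ Before w ρ i ⌋
    order .empty = false , false , false
    order .val-zero w ρ = cong₂ _,_ (⌊⌋-no (¬in-zero w)) (cong₂ _,_ (⌊⌋-no (¬in-zero w)) (⌊⌋-no (¬in-zero w ∘ proj₁)))
    order .val-node w ρ i p = cong₂ _,_ (present x) (cong₂ _,_ (present y) (⌊⌋-≡ before-to before-from))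
      where
      inˡ inʳ : ∀ z → Bool
      inˡ z = ⌊ In w (child w left i) (ρ z) ⌋
      inʳ z = ⌊ In w (child w right i) (ρ z) ⌋
      beforeˡ beforeʳ : Bool
      beforeˡ = ⌊ Before w ρ (child w left i) ⌋
      beforeʳ = ⌊ Before w ρ (child w right i) ⌋
      below : ∀ d z → In w (child w d i) (ρ z) → inˡ z ∨ inʳ z ≡ true
      below left  z h = ∨-fromˡ (⌊⌋-from h)
      below right z h = ∨-fromʳ {inˡ z} (⌊⌋-from h)
      below-from : ∀ z → inˡ z ∨ inʳ z ≡ true → Σ Dir λ d → In w (child w d i) (ρ z)
      below-from z e with ∨-to {inˡ z} e
      ... | inj₁ l = left , ⌊⌋-to l
      ... | inj₂ r = right , ⌊⌋-to r
      present : ∀ z → ⌊ In w i (ρ z) ⌋ ≡ lookup (marks ρ i) z ∨ (inˡ z ∨ inʳ z)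
      present z = ⌊⌋-≡ pto pfrom
        where
        pto : In w i (ρ z) → lookup (marks ρ i) z ∨ (inˡ z ∨ inʳ z) ≡ true
        pto h with in-cases w h
        ... | inj₁ e        = ∨-fromˡ (marked-from ρ z e)
        ... | inj₂ (d , h′) = ∨-fromʳ {lookup (marks ρ i) z} (below d z h′)
        pfrom : lookup (marks ρ i) z ∨ (inˡ z ∨ inʳ z) ≡ true → In w i (ρ z)
        pfrom e with ∨-to {lookup (marks ρ i) z} e
        ... | inj₁ e′ = subst (In w i) (sym (marked-to ρ z e′)) (in-root w p)
        ... | inj₂ e′ = in-up w (proj₂ (below-from z e′))
      result : Bool
      result = (lookup (marks ρ i) x ∧ (inˡ y ∨ inʳ y)) ∨ ((inˡ x ∧ inʳ y) ∨ (beforeˡ ∨ beforeʳ))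
      skip : ∀ {b} → b ≡ true → (lookup (marks ρ i) x ∧ (inˡ y ∨ inʳ y)) ∨ b ≡ true
      skip = ∨-fromʳ {lookup (marks ρ i) x ∧ (inˡ y ∨ inʳ y)}
      before-to : Before w ρ i → result ≡ true
      before-to (hx , hy , x<y) with in-cases w hx | in-cases w hy
      ... | inj₁ e | inj₁ e′ = ⊥-elim (<-irrefl (trans e (sym e′)) x<y)
      ... | inj₁ e | inj₂ (d , h) = ∨-fromˡ (∧-from (marked-from ρ x e) (below d y h))
      ... | inj₂ (d , h) | inj₁ e = ⊥-elim (<-asym x<y (subst (_< ρ x) (sym e) (in-child-< w h)))
      ... | inj₂ (left , h) | inj₂ (left , h′) =
        skip (∨-fromʳ {inˡ x ∧ inʳ y} (∨-fromˡ (⌊⌋-from (h , h′ , x<y))))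
      ... | inj₂ (left , h) | inj₂ (right , h′) =
        skip (∨-fromˡ (∧-from (⌊⌋-from h) (⌊⌋-from h′)))
      ... | inj₂ (right , h) | inj₂ (left , h′) = ⊥-elim (<-asym x<y (in-left-right w h′ h))
      ... | inj₂ (right , h) | inj₂ (right , h′) =
        skip (∨-fromʳ {inˡ x ∧ inʳ y} (∨-fromʳ {beforeˡ} (⌊⌋-from (h , h′ , x<y))))
      lift : ∀ d → Before w ρ (child w d i) → Before w ρ i
      lift d (h , h′ , x<y) = in-up w h , in-up w h′ , x<y
      before-from : result ≡ true → Before w ρ i
      before-from e with ∨-to {lookup (marks ρ i) x ∧ (inˡ y ∨ inʳ y)} e
      ... | inj₁ e₁ = let mx , by = ∧-to e₁
                          d , h = below-from y by
                          ρx≡i = marked-to ρ x mx in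
        subst (In w i) (sym ρx≡i) (in-root w p) , in-up w h , subst (_< ρ y) (sym ρx≡i) (in-child-< w h)
      ... | inj₂ e₁ with ∨-to {inˡ x ∧ inʳ y} e₁
      ...   | inj₁ e₂ = let l , r = ∧-to e₂ in
        in-up w (⌊⌋-to l) , in-up w (⌊⌋-to r) , in-left-right w (⌊⌋-to l) (⌊⌋-to r)
      ...   | inj₂ e₂ with ∨-to {beforeˡ} e₂
      ...     | inj₁ l = lift left (⌊⌋-to l)
      ...     | inj₂ r = lift right (⌊⌋-to r)
    order .val-local w ρ σ i ag = cong₂ _,_ (in-≡ x) (cong₂ _,_ (in-≡ y)
      (⌊⌋-cong (mk⇔ (before-local ag) (before-local (agree-sym w ag)))))
      where
      in-≡ : ∀ z → ⌊ In w i (ρ z) ⌋ ≡ ⌊ In w i (σ z) ⌋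
      in-≡ z = ⌊⌋-cong (mk⇔ (In-cong w ag z) (In-cong w (agree-sym w ag) z))
      before-local : ∀ {ρ σ} → Agree w i ρ σ → Before w ρ i → Before w σ i
      before-local ag (hx , hy , x<y) = In-cong w ag x hx , In-cong w ag y hy ,
        subst₂ _<_ (agree-in w ag x hx) (agree-in w ag y hy) x<y
    order .dval t = dresp (dconst ((false , false , false) ≡ t)) λ w i _ →
      mk⇔ (trans (absent w)) (trans (sym (absent w)))
      where
      absent : ∀ w {i} → order .val w unmarked i ≡ (false , false , false)
      absent w = cong₂ _,_ (⌊⌋-no (¬in-0 w)) (cong₂ _,_ (⌊⌋-no (¬in-0 w)) (⌊⌋-no (¬in-0 w ∘ proj₁)))

    recognize-< : Recognizer (x <ᶠ y)
    recognize-< = record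
      { algebra = order
      ; accept  = λ (_ , _ , c) → c ≡ true
      ; correct = λ w ρ _ q → mk⇔
          (λ x<y → ⌊⌋-from (in-first w _ (q x) , in-first w _ (q y) , x<y))
          (λ e → proj₂ (proj₂ (⌊⌋-to {Before w ρ 1} e)))
      }

  module Matching {n : ℕ} (x y : Fin n) where

    Root Matched : NestedWord m → (Fin n → ℕ) → ℕ → Set
    Root w ρ i = Pos w i × ρ y ≡ i
    Matched w ρ i = In w i (ρ x) × μ w (ρ x) (ρ y)

    -- The return is the right child of the call, so a subtree containing `x` contains `y`. This
    -- makes `Matched` local although it places only `x`.
    matched-in : ∀ w {ρ : Fin n → ℕ} {i} → Matched w ρ i → In w i (ρ y)
    matched-in w ((p , π) , q) = p , snoc π
      (right , call-pos w (μ-call w q) , ret-pos w (μ-ret w q) , inj₁ q) tt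

    -- The pair is detected at the call, from the root of its right subtree. The flag `mc` is
    -- essential there: the right child of any other node is merely its successor.
    step : Kind → Marks n → Bool × Bool → Bool × Bool → Bool × Bool
    step (_ , _ , _ , mc) M (_ , c) (r′ , c′) = lookup M y , (lookup M x ∧ (mc ∧ r′)) ∨ (c ∨ c′)

    -- An unmarked node clears the first flag, and it stays cleared, so its absence is what counts
    -- as growth.
    matching-weight : Bool × Bool → ℕ
    matching-weight (r , c) = weight (not r) + weight c

    matching : Algebra n
    matching .T = Bool × Bool
    matching .finite = finite-× finite-Bool finite-Bool
    matching .node = step
    matching .aperiodic c = 2 , grows-aperiodic matching-weight 2
      (λ (r , c) → +-mono-≤ (weight≤1 (not r)) (weight≤1 c))
      (context-grows matching-weight
        (λ (_ , _ , _ , mc) (r , c) (r′ , c′) → grows-× (weight ∘ not) weight (off r)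
          (grows-∨ʳ (lookup none x ∧ (mc ∧ r′)) (grows-∨ˡ c′ grows-refl)))
        (λ (_ , _ , _ , mc) (r , c) (r′ , c′) → grows-× (weight ∘ not) weight (off r′)
          (grows-∨ʳ (lookup none x ∧ (mc ∧ r′)) (grows-∨ʳ c grows-refl)))
        c)
      where
      off : ∀ r → Grows (weight ∘ not) r (lookup none y)
      off r rewrite lookup-replicate y false with r
      ... | false = inj₁ refl
      ... | true  = inj₂ (s≤s z≤n)
    matching .val w ρ i = ⌊ Root w ρ i ⌋ , ⌊ Matched w ρ i ⌋
    matching .empty = false , false
    matching .val-zero w ρ = cong₂ _,_ (⌊⌋-no λ { ((() , _) , _) }) (⌊⌋-no (¬in-zero w ∘ proj₁))
    matching .val-node w ρ i p = cong₂ _,_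
      (⌊⌋-≡ (λ (_ , e) → marked-from ρ y e) (λ e → p , marked-to ρ y e)) (⌊⌋-≡ mto mfrom)
      where
      here? : Bool
      here? = lookup (marks ρ i) x ∧ (⌊ MCall w i ⌋ ∧ ⌊ Root w ρ (child w right i) ⌋)
      result : Bool
      result = here? ∨ (⌊ Matched w ρ (child w left i) ⌋ ∨ ⌊ Matched w ρ (child w right i) ⌋)
      mto : Matched w ρ i → result ≡ true
      mto (h , q) with in-cases w h
      ... | inj₂ (left , h′)  = ∨-fromʳ {here?} (∨-fromˡ (⌊⌋-from (h′ , q)))
      ... | inj₂ (right , h′) = ∨-fromʳ {here?} (∨-fromʳ {⌊ Matched w ρ (child w left i) ⌋} (⌊⌋-from (h′ , q)))
      ... | inj₁ e = ∨-fromˡ (∧-from (marked-from ρ x e) (∧-from (⌊⌋-from (_ , q′))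
          (⌊⌋-from (subst (Pos w) (sym c) (ret-pos w (μ-ret w q)) , sym c))))
        where
        q′ : μ w i (ρ y)
        q′ = subst (λ i → μ w i (ρ y)) e q
        c : child w right i ≡ ρ y
        c = child-≡ w (p , ret-pos w (μ-ret w q) , inj₁ q′)
      mfrom : result ≡ true → Matched w ρ i
      mfrom e with ∨-to {here?} e
      ... | inj₂ e₁ with ∨-to {⌊ Matched w ρ (child w left i) ⌋} e₁
      ...   | inj₁ l = let h , q = ⌊⌋-to l in in-up w h , q
      ...   | inj₂ r = let h , q = ⌊⌋-to r in in-up w h , q
      mfrom e | inj₁ e₁ with ∧-to {lookup (marks ρ i) x} e₁
      ... | e₂ , e₃ with ∧-to {⌊ MCall w i ⌋} e₃
      ... | e₄ , e₅ with ⌊⌋-to {MCall w i} e₄ | ⌊⌋-to {Root w ρ (child w right i)} e₅ | marked-to ρ x e₂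
      ... | t , q | _ , ρy≡ | refl = in-root w p ,
        subst (μ w i) (sym (trans ρy≡ (child-≡ w (p , ret-pos w (μ-ret w q) , inj₁ q)))) q
    matching .val-local w ρ σ i ag = cong₂ _,_
      (⌊⌋-cong (mk⇔ (root-local ag) (root-local (agree-sym w ag))))
      (⌊⌋-cong (mk⇔ (matched-local ag) (matched-local (agree-sym w ag))))
      where
      root-local : ∀ {ρ σ} → Agree w i ρ σ → Root w ρ i → Root w σ i
      root-local {ρ} ag (p , e) = p , trans (sym (agree-in w ag y (subst (In w i) (sym e) (in-root w p)))) e
      matched-local : ∀ {ρ σ} → Agree w i ρ σ → Matched w ρ i → Matched w σ i
      matched-local ag h@(hx , q) = subst (In w i) (agree-in w ag x hx) hx ,
        subst₂ (μ w) (agree-in w ag x hx) (agree-in w ag y (matched-in w h)) q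
    matching .dval t = dresp (dconst ((false , false) ≡ t)) λ w i p →
      mk⇔ (trans (absent w p)) (trans (sym (absent w p)))
      where
      absent : ∀ w {i} → Pos w i → matching .val w unmarked i ≡ (false , false)
      absent w p = cong₂ _,_ (⌊⌋-no λ { (_ , refl) → n≮0 (proj₁ p) }) (⌊⌋-no (¬in-0 w ∘ proj₁))

    recognize-μ : Recognizer (μᶠ x y)
    recognize-μ = record
      { algebra = matching
      ; accept  = λ (_ , c) → c ≡ true
      ; correct = λ w ρ _ q → mk⇔
          (λ h → ⌊⌋-from (in-first w _ (q x) , h)) (λ e → proj₂ (⌊⌋-to {Matched w ρ 1} e))
      }

-- Connectives and quantifiers

module Completeness (em : ExcludedMiddle 0ℓ) {m : ℕ} where

  open Definability em {m}
  open Kamp em {m}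
  open Tree em {m}
  open Algebras em {m}
  open Recognition em {m}
  open Algebra
  open Recognizer

  recognize-¬ : ∀ {n} {φ : FO m n} → Recognizer φ → Recognizer (¬ᶠ φ)
  recognize-¬ R = record
    { algebra = algebra R
    ; accept  = λ t → ¬ accept R t
    ; correct = λ w ρ p q → mk⇔ (λ k → k ∘ from (correct R w ρ p q)) (λ k → k ∘ to (correct R w ρ p q))
    }

  module Product {n : ℕ} (𝓐 𝓑 : Algebra n) where

    step : Kind → Marks n → T 𝓐 × T 𝓑 → T 𝓐 × T 𝓑 → T 𝓐 × T 𝓑
    step k M (a , b) (a′ , b′) = node 𝓐 k M a a′ , node 𝓑 k M b b′

    context-split : ∀ {g} → Context step g → Σ (T 𝓐 → T 𝓐) λ g₁ → Σ (T 𝓑 → T 𝓑) λ g₂ →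
      Context (node 𝓐) g₁ × Context (node 𝓑) g₂ × (∀ a b → g (a , b) ≡ (g₁ a , g₂ b))
    context-split (ctx-left k (a , b))  = _ , _ , ctx-left k a , ctx-left k b , λ _ _ → refl
    context-split (ctx-right k (a , b)) = _ , _ , ctx-right k a , ctx-right k b , λ _ _ → refl
    context-split (ctx-∘ {g} c d) with context-split c | context-split d
    ... | g₁ , g₂ , c₁ , c₂ , e | h₁ , h₂ , d₁ , d₂ , e′ =
      g₁ ∘ h₁ , g₂ ∘ h₂ , ctx-∘ c₁ d₁ , ctx-∘ c₂ d₂ , λ a b → trans (cong g (e′ a b)) (e _ _)

    iter-split : ∀ {g : T 𝓐 × T 𝓑 → T 𝓐 × T 𝓑} {g₁ g₂} → (∀ a b → g (a , b) ≡ (g₁ a , g₂ b)) →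
                 ∀ k a b → iter k g (a , b) ≡ (iter k g₁ a , iter k g₂ b)
    iter-split e zero a b = refl
    iter-split {g} e (suc k) a b = trans (cong g (iter-split e k a b)) (e _ _)

    product : Algebra n
    product .T = T 𝓐 × T 𝓑
    product .finite = finite-× (finite 𝓐) (finite 𝓑)
    product .node = step
    product .aperiodic c with context-split c
    ... | g₁ , g₂ , c₁ , c₂ , e with aperiodic 𝓐 c₁ | aperiodic 𝓑 c₂
    -- An exponent stays valid when increased, so the sum serves both components.
    ... | k , p | l , q = k + l , λ (a , b) → trans (iter-split e (k + l) a b)
      (trans (cong₂ _,_ (iter-stable p (m≤m+n k l) a) (iter-stable q (m≤n+m l k) b))
             (sym (iter-split e (suc (k + l)) a b)))
    product .val w ρ i = val 𝓐 w ρ i , val 𝓑 w ρ i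
    product .empty = empty 𝓐 , empty 𝓑
    product .val-zero w ρ = cong₂ _,_ (val-zero 𝓐 w ρ) (val-zero 𝓑 w ρ)
    product .val-node w ρ i p = cong₂ _,_ (val-node 𝓐 w ρ i p) (val-node 𝓑 w ρ i p)
    product .val-local w ρ σ i ag = cong₂ _,_ (val-local 𝓐 w ρ σ i ag) (val-local 𝓑 w ρ σ i ag)
    product .dval (a , b) = dresp (dand (dval 𝓐 a) (dval 𝓑 b)) λ _ _ _ →
      mk⇔ (λ (e , e′) → cong₂ _,_ e e′) (λ { refl → refl , refl })

  recognize-∨ : ∀ {n} {φ ψ : FO m n} → Recognizer φ → Recognizer ψ → Recognizer (φ ∨ᶠ ψ)
  recognize-∨ R R′ = record
    { algebra = Product.product (algebra R) (algebra R′)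
    ; accept  = λ (a , b) → accept R a ⊎ accept R′ b
    ; correct = λ w ρ p q → mk⇔ (map (to (correct R w ρ p q)) (to (correct R′ w ρ p q)))
                                (map (from (correct R w ρ p q)) (from (correct R′ w ρ p q)))
    }

  -- Existential quantification as a powerset construction

  module Projection {n : ℕ} (𝓐 : Algebra (suc n)) where

    X : Set
    X = T 𝓐

    Subset : Set
    Subset = Table (finite 𝓐) Bool

    _∋_ : Subset → X → Set
    A ∋ s = apply (finite 𝓐) A s ≡ true

    abstract
      ⟪_⟫ : (X → Set) → Subset
      ⟪ B ⟫ = table (finite 𝓐) λ s → ⌊ B s ⌋

      ∋-to : ∀ {B s} → ⟪ B ⟫ ∋ s → B s
      ∋-to {B} {s} e = ⌊⌋-to (trans (sym (apply-table (finite 𝓐) (λ s → ⌊ B s ⌋) s)) e)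

      ∋-from : ∀ {B s} → B s → ⟪ B ⟫ ∋ s
      ∋-from {B} {s} b = trans (apply-table (finite 𝓐) (λ s → ⌊ B s ⌋) s) (⌊⌋-from b)

      ⟪⟫-cong : ∀ {B C} → (∀ s → B s ⇔ C s) → ⟪ B ⟫ ≡ ⟪ C ⟫
      ⟪⟫-cong h = table-cong (finite 𝓐) λ s → ⌊⌋-cong (h s)

      ⟪⟫-entries : ∀ {B A} →
        (∀ k → ⌊ B (List.lookup (elems (finite 𝓐)) k) ⌋ ≡ lookup A k) ⇔ (⟪ B ⟫ ≡ A)
      ⟪⟫-entries {B} {A} = mk⇔ (λ h → trans (tabulate-cong h) (tabulate∘lookup A))
        λ e k → trans (sym (lookup∘tabulate (λ k → ⌊ B (List.lookup (elems (finite 𝓐)) k) ⌋) k))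
                      (cong (λ v → lookup v k) e)

    Image : Kind → Marks n → X × Subset → X × Subset → X → Set
    Image k M (t , A) (t′ , A′) s = s ≡ node 𝓐 k (true ∷ M) t t′ ⊎
      (Σ X λ r → A ∋ r × s ≡ node 𝓐 k (false ∷ M) r t′) ⊎
      (Σ X λ r → A′ ∋ r × s ≡ node 𝓐 k (false ∷ M) t r)

    step : Kind → Marks n → X × Subset → X × Subset → X × Subset
    step k M p@(t , _) p′@(t′ , _) = node 𝓐 k (false ∷ M) t t′ , ⟪ Image k M p p′ ⟫

    -- A context acts on the unmarked value by g, and on the set of marked values by
    -- g together with the transformations in H, which place the mark inside the context.
    record Action (f : X × Subset → X × Subset) : Set₁ where
      field
        g       : X → X
        g-ctx   : Context (node 𝓐) g
        H       : (X → X) → Set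
        first   : ∀ p → proj₁ (f p) ≡ g (proj₁ p)
        tabular : ∀ p → Σ (X → Set) λ B → proj₂ (f p) ≡ ⟪ B ⟫
        second  : ∀ p s → (proj₂ (f p) ∋ s) ⇔
          ((Σ X λ r → proj₂ p ∋ r × s ≡ g r) ⊎ (Σ (X → X) λ h → H h × s ≡ h (proj₁ p)))

    open Action

    action : ∀ {f} → Context step f → Action f
    action (ctx-left k (t , A)) = record
      { g = λ s → node 𝓐 k none s t
      ; g-ctx = ctx-left k t
      ; H = λ h → (∀ s → h s ≡ node 𝓐 k (true ∷ none) s t) ⊎
                  (Σ X λ r → A ∋ r × (∀ s → h s ≡ node 𝓐 k none s r))
      ; first = λ _ → refl
      ; tabular = λ _ → _ , refl
      ; second = λ p s → mk⇔
          (λ e → classify p (∋-to e))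
          (λ { (inj₁ e) → ∋-from (inj₂ (inj₁ e))
             ; (inj₂ (h , inj₁ e , refl)) → ∋-from (inj₁ (e _))
             ; (inj₂ (h , inj₂ (r , m , e) , refl)) → ∋-from (inj₂ (inj₂ (r , m , e _))) })
      }
      where
      classify : ∀ p {s} → Image k none p (t , A) s → _
      classify p (inj₁ e)                    = inj₂ (_ , inj₁ (λ _ → refl) , e)
      classify p (inj₂ (inj₁ e))             = inj₁ e
      classify p (inj₂ (inj₂ (r , m , e)))   = inj₂ (_ , inj₂ (r , m , λ _ → refl) , e)
    action (ctx-right k (t , A)) = record
      { g = λ s → node 𝓐 k none t s
      ; g-ctx = ctx-right k t
      ; H = λ h → (∀ s → h s ≡ node 𝓐 k (true ∷ none) t s) ⊎
                  (Σ X λ r → A ∋ r × (∀ s → h s ≡ node 𝓐 k none r s))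
      ; first = λ _ → refl
      ; tabular = λ _ → _ , refl
      ; second = λ p s → mk⇔
          (λ e → classify p (∋-to e))
          (λ { (inj₁ e) → ∋-from (inj₂ (inj₂ e))
             ; (inj₂ (h , inj₁ e , refl)) → ∋-from (inj₁ (e _))
             ; (inj₂ (h , inj₂ (r , m , e) , refl)) → ∋-from (inj₂ (inj₁ (r , m , e _))) })
      }
      where
      classify : ∀ p {s} → Image k none (t , A) p s → _
      classify p (inj₁ e)                    = inj₂ (_ , inj₁ (λ _ → refl) , e)
      classify p (inj₂ (inj₂ e))             = inj₁ e
      classify p (inj₂ (inj₁ (r , m , e)))   = inj₂ (_ , inj₂ (r , m , λ _ → refl) , e)
    action (ctx-∘ {f} {f′} c c′) = record
      { g = g 𝓕 ∘ g 𝓕′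
      ; g-ctx = ctx-∘ (g-ctx 𝓕) (g-ctx 𝓕′)
      -- The mark lies in the inner context and passes through the outer one, or it lies in the
      -- outer context and the inner one acts unmarked.
      ; H = λ h → (Σ (X → X) λ h′ → H 𝓕′ h′ × (∀ s → h s ≡ g 𝓕 (h′ s))) ⊎
                  (Σ (X → X) λ h′ → H 𝓕 h′ × (∀ s → h s ≡ h′ (g 𝓕′ s)))
      ; first = λ p → trans (first 𝓕 (f′ p)) (cong (g 𝓕) (first 𝓕′ p))
      ; tabular = λ p → tabular 𝓕 (f′ p)
      ; second = λ p s → mk⇔
          (λ e → down p (to (second 𝓕 (f′ p) s) e))
          (λ h → from (second 𝓕 (f′ p) s) (up p h))
      }
      where
      𝓕 : Action f
      𝓕 = action c
      𝓕′ : Action f′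
      𝓕′ = action c′
      Out In′ : X × Subset → X → Set
      Out p s = (Σ X λ r → proj₂ p ∋ r × s ≡ g 𝓕 (g 𝓕′ r)) ⊎
        (Σ (X → X) λ h → ((Σ (X → X) λ h′ → H 𝓕′ h′ × (∀ s → h s ≡ g 𝓕 (h′ s))) ⊎
                          (Σ (X → X) λ h′ → H 𝓕 h′ × (∀ s → h s ≡ h′ (g 𝓕′ s)))) × s ≡ h (proj₁ p))
      In′ p s = (Σ X λ r → proj₂ (f′ p) ∋ r × s ≡ g 𝓕 r) ⊎
        (Σ (X → X) λ h → H 𝓕 h × s ≡ h (proj₁ (f′ p)))
      down : ∀ p {s} → In′ p s → Out p s
      down p (inj₁ (r , m , refl)) with to (second 𝓕′ p r) m
      ... | inj₁ (q , m′ , refl) = inj₁ (q , m′ , refl)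
      ... | inj₂ (h , m′ , refl) = inj₂ (_ , inj₁ (h , m′ , λ _ → refl) , refl)
      down p (inj₂ (h , m , refl)) = inj₂ (_ , inj₂ (h , m , λ _ → refl) , cong h (first 𝓕′ p))
      up : ∀ p {s} → Out p s → In′ p s
      up p (inj₁ (r , m , refl)) = inj₁ (_ , from (second 𝓕′ p _) (inj₁ (r , m , refl)) , refl)
      up p (inj₂ (h , inj₁ (h′ , m , e) , refl)) =
        inj₁ (_ , from (second 𝓕′ p _) (inj₂ (h′ , m , refl)) , e _)
      up p (inj₂ (h , inj₂ (h′ , m , e) , refl)) =
        inj₂ (h′ , m , trans (e _) (cong h′ (sym (first 𝓕′ p))))

    module _ {f} (𝓕 : Action f) where

      -- After `k` rounds the mark either came with the argument or was placed in exactly one of the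
      -- `k` copies of the context, with `b` unmarked copies inside and `a` outside.
      Placed : ℕ → X × Subset → X → Set
      Placed k (t , A) s = (Σ X λ r → A ∋ r × s ≡ iter k (g 𝓕) r) ⊎
        (Σ (X → X) λ h → H 𝓕 h × Σ ℕ λ a → Σ ℕ λ b → a + suc b ≡ k × s ≡ iter a (g 𝓕) (h (iter b (g 𝓕) t)))

      iter-first : ∀ k p → proj₁ (iter k f p) ≡ iter k (g 𝓕) (proj₁ p)
      iter-first zero    p = refl
      iter-first (suc k) p = trans (first 𝓕 _) (cong (g 𝓕) (iter-first k p))

      iter-second : ∀ k p s → (proj₂ (iter k f p) ∋ s) ⇔ Placed k p s
      iter-second zero p s = mk⇔ (λ m → inj₁ (s , m , refl))
        λ { (inj₁ (_ , m , refl)) → m ; (inj₂ (_ , _ , zero , _ , () , _)) ; (inj₂ (_ , _ , suc _ , _ , () , _)) }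
      iter-second (suc k) p s = mk⇔ (λ m → unroll (to (second 𝓕 (iter k f p) s) m))
                                    (λ h → from (second 𝓕 (iter k f p) s) (roll h))
        where
        Last : Set
        Last = (Σ X λ r → proj₂ (iter k f p) ∋ r × s ≡ g 𝓕 r) ⊎
               (Σ (X → X) λ h → H 𝓕 h × s ≡ h (proj₁ (iter k f p)))
        unroll : Last → Placed (suc k) p s
        unroll (inj₂ (h , m , refl)) = inj₂ (h , m , 0 , k , refl , cong h (iter-first k p))
        unroll (inj₁ (r , m , refl)) with to (iter-second k p r) m
        ... | inj₁ (q , m′ , refl) = inj₁ (q , m′ , refl)
        ... | inj₂ (h , m′ , a , b , e , refl) = inj₂ (h , m′ , suc a , b , cong suc e , refl)
        roll : Placed (suc k) p s → Last
        roll (inj₁ (q , m , refl)) = inj₁ (_ , from (iter-second k p _) (inj₁ (q , m , refl)) , refl)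
        roll (inj₂ (h , m , zero , b , refl , refl)) = inj₂ (h , m , cong h (sym (iter-first b p)))
        roll (inj₂ (h , m , suc a , b , e , refl)) =
          inj₁ (_ , from (iter-second k p _) (inj₂ (h , m , a , b , suc-injective e , refl)) , refl)

      -- A factorisation g^a h g^b with a + b ≥ 2k has an exponent at least k, which can be
      -- changed by one without changing the value.
      placed-stable : ∀ {k} → (∀ s → iter k (g 𝓕) s ≡ iter (suc k) (g 𝓕) s) → ∀ p s →
        Placed (suc (suc (k + k))) p s ⇔ Placed (suc (suc (suc (k + k)))) p s
      placed-stable {k} ap p s = mk⇔ fwd bwd
        where
        big : k ≤ suc (suc (k + k))
        big = ≤-trans (m≤m+n k k) (≤-trans (n≤1+n _) (n≤1+n _))
        split : ∀ {a b} → a + suc b ≡ suc (suc (k + k)) → k ≤ a ⊎ k ≤ b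
        split {a} {b} e with <-≤-connex a k
        ... | inj₂ k≤a = inj₁ k≤a
        ... | inj₁ a<k = inj₂ (≮⇒≥ λ b<k → <-irrefl e (≤-<-trans (+-mono-≤ (<⇒≤ a<k) b<k) (s≤s (n≤1+n _))))
        fwd : Placed (suc (suc (k + k))) p s → Placed (suc (suc (suc (k + k)))) p s
        fwd (inj₁ (r , m , e)) = inj₁ (r , m , trans e (iter-stable {k = k} ap big r))
        fwd (inj₂ (h , m , a , b , e , refl)) with split {a} e
        ... | inj₁ k≤a = inj₂ (h , m , suc a , b , cong suc e , iter-stable ap k≤a _)
        ... | inj₂ k≤b = inj₂ (h , m , a , suc b , trans (+-suc a (suc b)) (cong suc e) ,
                               cong (λ t → iter a (g 𝓕) (h t)) (iter-stable ap k≤b _))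
        -- To lower an exponent by one it must be at least `suc k`; here `a + b` is `2k + 2`, so `a`
        -- and `b` cannot both be at most `k`.
        split′ : ∀ {a b} → a + suc b ≡ suc (suc (suc (k + k))) → suc k ≤ a ⊎ suc k ≤ b
        split′ {a} {b} e with <-≤-connex a (suc k)
        ... | inj₂ k<a = inj₁ k<a
        ... | inj₁ (s≤s a≤k) = inj₂ (≮⇒≥ λ { (s≤s b≤k) → <-irrefl e
              (≤-<-trans (+-mono-≤ a≤k (s≤s b≤k)) (subst (_< suc (suc (suc (k + k)))) (sym (+-suc k k)) (s≤s (n≤1+n _)))) })
        bwd : Placed (suc (suc (suc (k + k)))) p s → Placed (suc (suc (k + k))) p s
        bwd (inj₁ (r , m , e)) = inj₁ (r , m , trans e (sym (iter-stable {k = k} ap big r)))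
        bwd (inj₂ (h , m , a , b , e , refl)) with split′ {a} e
        bwd (inj₂ (h , m , suc a , b , e , refl)) | inj₁ (s≤s k≤a) =
          inj₂ (h , m , a , b , suc-injective e , sym (iter-stable ap k≤a _))
        bwd (inj₂ (h , m , a , suc b , e , refl)) | inj₂ (s≤s k≤b) =
          inj₂ (h , m , a , b , suc-injective (trans (sym (+-suc a (suc b))) e) ,
                cong (λ t → iter a (g 𝓕) (h t)) (sym (iter-stable ap k≤b _)))

      action-aperiodic : Σ ℕ λ k → ∀ p → iter k f p ≡ iter (suc k) f p
      action-aperiodic with aperiodic 𝓐 (g-ctx 𝓕)
      ... | k , ap = suc (suc (k + k)) , λ p → cong₂ _,_
        (trans (iter-first (suc (suc (k + k))) p)
          (trans (iter-stable ap (≤-trans (m≤m+n k k) (≤-trans (n≤1+n _) (n≤1+n _))) (proj₁ p))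
                 (sym (iter-first (suc (suc (suc (k + k)))) p))))
        (extensional (tabular 𝓕 _) (tabular 𝓕 _) λ s → mk⇔
          (from (iter-second (suc (suc (suc (k + k)))) p s) ∘ to (placed-stable {k} ap p s) ∘ to (iter-second (suc (suc (k + k))) p s))
          (from (iter-second (suc (suc (k + k))) p s) ∘ from (placed-stable {k} ap p s) ∘ to (iter-second (suc (suc (suc (k + k)))) p s)))
        where
        -- Restricted to tables of predicates: `elems` may list an element twice while `∋` reads
        -- only one of its entries, so arbitrary vectors are not determined by their members. After
        -- at least one application of `f` the second component is such a table.
        extensional : ∀ {A A′} → (Σ (X → Set) λ B → A ≡ ⟪ B ⟫) → (Σ (X → Set) λ B → A′ ≡ ⟪ B ⟫) →
                      (∀ s → (A ∋ s) ⇔ (A′ ∋ s)) → A ≡ A′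
        extensional (B , refl) (C , refl) h = ⟪⟫-cong λ s →
          mk⇔ (λ b → ∋-to (to (h s) (∋-from b))) (λ c → ∋-to (from (h s) (∋-from c)))

    Marked-value : NestedWord m → (Fin n → ℕ) → ℕ → X → Set
    Marked-value w ρ i s = Σ ℕ λ j → In w i j × s ≡ val 𝓐 w (extend j ρ) i

    unmark : ∀ w (ρ : Fin n → ℕ) {i j} → ¬ In w i j → val 𝓐 w (extend j ρ) i ≡ val 𝓐 w (extend 0 ρ) i
    unmark w ρ {i} {j} ¬h = val-local 𝓐 w (extend j ρ) (extend 0 ρ) i λ
      { zero → inj₂ (¬h , ¬in-0 w) ; (suc x) → inj₁ refl }

    project : Algebra n
    project .T = X × Subset
    project .finite = finite-× (finite 𝓐) (finite-Vec finite-Bool _)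
    project .node = step
    project .aperiodic c = action-aperiodic (action c)
    project .val w ρ i = val 𝓐 w (extend 0 ρ) i , ⟪ Marked-value w ρ i ⟫
    project .empty = empty 𝓐 , ⟪ (λ _ → ⊥) ⟫
    project .val-zero w ρ = cong₂ _,_ (val-zero 𝓐 w (extend 0 ρ))
      (⟪⟫-cong λ s → mk⇔ (λ (_ , h , _) → ¬in-zero w h) λ ())
    -- With the position written as a successor, the flag of the absent mark 0 reduces to `false`.
    project .val-node w ρ (suc i′) p = cong₂ _,_ (val-node 𝓐 w (extend 0 ρ) i p)
      (⟪⟫-cong λ s → mk⇔ mto mfrom)
      where
      i : ℕ
      i = suc i′
      M : Marks n
      M = marks ρ i
      value : Dir → X
      value d = val 𝓐 w (extend 0 ρ) (child w d i)
      pair : Dir → X × Subset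
      pair d = value d , ⟪ Marked-value w ρ (child w d i) ⟫
      at-root : val 𝓐 w (extend i ρ) i ≡ node 𝓐 (kind w i) (true ∷ M) (value left) (value right)
      at-root = trans (val-node 𝓐 w (extend i ρ) i p)
        (trans (cong (λ b → node 𝓐 (kind w i) (b ∷ M) (val 𝓐 w (extend i ρ) (child w left i))
            (val 𝓐 w (extend i ρ) (child w right i))) (dec-true (i ≟ i) refl))
          (cong₂ (node 𝓐 (kind w i) (true ∷ M)) (away left) (away right)))
        where
        away : ∀ d → val 𝓐 w (extend i ρ) (child w d i) ≡ value d
        away d = unmark w ρ λ h → <-irrefl refl (in-child-< w h)
      in-child-value : ∀ {j} → i < j → val 𝓐 w (extend j ρ) i ≡
        node 𝓐 (kind w i) (false ∷ M) (val 𝓐 w (extend j ρ) (child w left i)) (val 𝓐 w (extend j ρ) (child w right i))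
      in-child-value {j} i<j = trans (val-node 𝓐 w (extend j ρ) i p)
        (cong (λ b → node 𝓐 (kind w i) (b ∷ M) (val 𝓐 w (extend j ρ) (child w left i))
            (val 𝓐 w (extend j ρ) (child w right i))) (dec-false (j ≟ i) λ { refl → <-irrefl refl i<j }))
      in-left : ∀ {j} → In w (child w left i) j → val 𝓐 w (extend j ρ) i ≡
        node 𝓐 (kind w i) (false ∷ M) (val 𝓐 w (extend j ρ) (child w left i)) (value right)
      in-left h = trans (in-child-value (in-child-< w h))
        (cong (node 𝓐 (kind w i) (false ∷ M) _) (unmark w ρ (in-disjoint w h)))
      in-right : ∀ {j} → In w (child w right i) j → val 𝓐 w (extend j ρ) i ≡
        node 𝓐 (kind w i) (false ∷ M) (value left) (val 𝓐 w (extend j ρ) (child w right i))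
      in-right {j} h = trans (in-child-value (in-child-< w h))
        (cong (λ t → node 𝓐 (kind w i) (false ∷ M) t (val 𝓐 w (extend j ρ) (child w right i))) (unmark w ρ λ h′ → in-disjoint w h′ h))
      mto : ∀ {s} → Marked-value w ρ i s → Image (kind w i) M (pair left) (pair right) s
      mto (j , h , refl) with in-cases w h
      ... | inj₁ refl         = inj₁ at-root
      ... | inj₂ (left , h′)  = inj₂ (inj₁ (_ , ∋-from (j , h′ , refl) , in-left h′))
      ... | inj₂ (right , h′) = inj₂ (inj₂ (_ , ∋-from (j , h′ , refl) , in-right h′))
      mfrom : ∀ {s} → Image (kind w i) M (pair left) (pair right) s → Marked-value w ρ i s
      mfrom (inj₁ refl) = i , in-root w p , sym at-root
      mfrom (inj₂ (inj₁ (r , e , refl))) with ∋-to e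
      ... | j , h , refl = j , in-up w h , sym (in-left h)
      mfrom (inj₂ (inj₂ (r , e , refl))) with ∋-to e
      ... | j , h , refl = j , in-up w h , sym (in-right h)
    project .val-local w ρ σ i ag = cong₂ _,_ (local 0)
      (⟪⟫-cong λ s → mk⇔ (λ (j , h , e) → j , h , trans e (local j)) (λ (j , h , e) → j , h , trans e (sym (local j))))
      where
      local : ∀ j → val 𝓐 w (extend j ρ) i ≡ val 𝓐 w (extend j σ) i
      local j = val-local 𝓐 w (extend j ρ) (extend j σ) i λ { zero → inj₁ refl ; (suc x) → ag x }
    project .dval (t , A) = dresp
      -- The set is compared entry by entry; an entry states whether some placement of the mark
      -- below yields that value.
      (dand (dval 𝓐 t) (dall (finite-Fin _) λ k →
        dflag (Marked.dvalSome 𝓐 (List.lookup (elems (finite 𝓐)) k)) (lookup A k)))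
      λ w i _ → mk⇔
        (λ (e , h) → cong₂ _,_ (trans (same w i) e) (to ⟪⟫-entries h))
        (λ { refl → sym (same w i) , from ⟪⟫-entries refl })
      where
      same : ∀ w i → val 𝓐 w (extend 0 unmarked) i ≡ val 𝓐 w unmarked i
      same w i = val-local 𝓐 w _ _ i λ { zero → inj₁ refl ; (suc x) → inj₁ refl }

  recognize-∃ : ∀ {n} {φ : FO m (suc n)} → Recognizer φ → Recognizer (∃ᶠ φ)
  recognize-∃ {φ = φ} R = record
    { algebra = project
    ; accept  = λ (_ , A) → Σ X λ s → (A ∋ s) × accept R s
    ; correct = λ w ρ p q → mk⇔
        (λ (j , r , h) → _ , ∋-from (j , in-first w j r , refl) ,
           to (correct R w (extend j ρ) p (λ { zero → r ; (suc x) → q x })) h)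
        (λ (s , m , a) → back w ρ p q (∋-to m) a)
    }
    where
    open Projection (algebra R)
    back : ∀ w ρ → Pos w 1 → (∀ x → Pos w (ρ x)) → ∀ {s} → Marked-value w ρ 1 s → accept R s →
           w ⊨ᶠ ∃ᶠ φ [ ρ ]
    back w ρ p q (j , (_ , π) , refl) a = j , r , from (correct R w (extend j ρ) p λ { zero → r ; (suc x) → q x }) a
      where
      r : Pos w j
      r = EdgeSystem.path-target-pos tree w p π

  recognize : ∀ {n} (φ : FO m n) → Recognizer φ
  recognize (P a x)   = recognize-P a x
  recognize (x ≐ y)   = recognize-≐ x y
  recognize (x <ᶠ y)  = Order.recognize-< x y
  recognize (μᶠ x y)  = Matching.recognize-μ x y
  recognize (callᶠ x) = recognize-call x
  recognize (retᶠ x)  = recognize-ret x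
  recognize (¬ᶠ φ)    = recognize-¬ (recognize φ)
  recognize (φ ∨ᶠ ψ)  = recognize-∨ (recognize φ) (recognize ψ)
  recognize (∃ᶠ φ)    = recognize-∃ (recognize φ)

  -- The free variable becomes the only mark, at the point of evaluation. Truth depends on the value
  -- at 1, which since makes visible from there.
  fromFO : (φ : FO m 1) → Def (λ w i → w ⊨ᶠ φ [ at i ])
  fromFO φ = dresp (dex (finite 𝓐) λ t → dand (dconst (accept R t)) (Marked.dvalRoot 𝓐 t)) λ w i p → mk⇔
    (λ { (t , a , refl) → from (sat w i p) (subst (accept R) (same w i) a) })
    (λ h → _ , to (sat w i p) h , same w i)
    where
    R : Recognizer φ
    R = recognize φ
    𝓐 : Algebra 1
    𝓐 = algebra R
    same : ∀ w i → val 𝓐 w (extend i unmarked) 1 ≡ val 𝓐 w (at i) 1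
    same w i = val-local 𝓐 w _ _ 1 λ { zero → inj₁ refl }
    sat : ∀ w i → Pos w i → (w ⊨ᶠ φ [ at i ]) ⇔ accept R (val 𝓐 w (at i) 1)
    sat w i p = correct R w (at i) (pos-≤ w ≤-refl (proj₁ p) p) λ _ → p

theorem4p1 : ExcludedMiddle 0ℓ → (m : ℕ) →
    ((φ : NWTL m) → Σ (FO m 1) λ φ' →
    (w : NestedWord m) (i : ℕ) → Pos w i →
    ((w , i ⊨ₙ φ) ⇔ (w ⊨ᶠ φ' [ at i ])))
    ×
    ((ψ : FO m 1) → Σ (NWTL m) λ ψ' →
    (w : NestedWord m) (i : ℕ) → Pos w i →
    ((w ⊨ᶠ ψ [ at i ]) ⇔ (w , i ⊨ₙ ψ')))
theorem4p1 em m = toFirstOrder , toTemporal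
  where
  open Translation em {m} using (toFO; module FDef)
  open Definability em {m} using (module Def)
  open Completeness em {m} using (fromFO)

  toFirstOrder : (φ : NWTL m) → Σ (FO m 1) λ φ' →
    (w : NestedWord m) (i : ℕ) → Pos w i → ((w , i ⊨ₙ φ) ⇔ (w ⊨ᶠ φ' [ at i ]))
  toFirstOrder φ = let D = toFO φ zero in FDef.formula D , λ w i p →
    let h = FDef.defines D w (at i) (λ _ → p) in mk⇔ (from h) (to h)

  toTemporal : (ψ : FO m 1) → Σ (NWTL m) λ ψ' →
    (w : NestedWord m) (i : ℕ) → Pos w i → ((w ⊨ᶠ ψ [ at i ]) ⇔ (w , i ⊨ₙ ψ'))
  toTemporal ψ = let D = fromFO ψ in Def.formula D , λ w i p →
    let h = Def.defines D w i p in mk⇔ (from h) (to h)
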